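{- Let $G$ be a connected finite simple bipartite graph with a perfect matching and $2n\geq 6$ vertices. Then $$0\leq gf(G)-Af(G)\leq \tfrac{1}{2}(n-1)(n-2),$$ and the right-hand equality holds if and only if $G$ is isomorphic to the complete bipartite graph $K_{n,n}$.
   Context: For a perfect matching $M$ of $G$, $af(G,M)$ is the minimum size of a subset $S\subseteq E(G)\setminus M$ such that $G-S$ (delete the edges of $S$) has a unique perfect matching, and $Af(G)=\max_M af(G,M)$ over all perfect matchings. $gf(G)$ is the minimum size of an edge subset $S$ such that no two distinct perfect matchings $M_1,M_2$ of $G$ satisfy $M_1\cap S=M_2\cap S$. -}

module Defs where

open import Data.Nat using (ℕ; zero; suc; _+_; _*_; _≤_; _<_; _<ᵇ_)
open import Data.Fin using (Fin; toℕ)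
open import Data.Bool using (Bool; true; false; _∧_; _xor_; if_then_else_; not)
open import Data.List using (List; map; allFin)
open import Data.Nat.ListAction using (sum)
import Data.Bool.Properties as BP
open import Data.Product using (Σ; ∃; _×_; _,_)
open import Relation.Binary.PropositionalEquality using (_≡_; _≢_)
open import Relation.Nullary using (¬_)
open import Function.Bundles using (_↔_; Inverse)

record Graph (m : ℕ) : Set where
  field
    adj   : Fin m → Fin m → Bool
    sym   : ∀ i j → adj i j ≡ adj j i
    irref : ∀ i → adj i i ≡ false
open Graph public

-- A set of (unordered) vertex pairs, given as a symmetric Bool relation.
-- An edge subset S of G additionally satisfies S ⊆ E(G).
EdgeSet : ℕ → Set
EdgeSet m = Fin m → Fin m → Bool

IsSym : ∀ {m} → EdgeSet m → Set
IsSym S = ∀ i j → S i j ≡ S j i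

_⊆E_ : ∀ {m} → EdgeSet m → Graph m → Set
S ⊆E G = IsSym S × (∀ i j → S i j ≡ true → adj G i j ≡ true)

Disjoint : ∀ {m} → EdgeSet m → EdgeSet m → Set
Disjoint S T = ∀ i j → S i j ≡ true → T i j ≡ false

_≈E_ : ∀ {m} → EdgeSet m → EdgeSet m → Set
S ≈E T = ∀ i j → S i j ≡ T i j

count : List Bool → ℕ
count bs = sum (map (λ b → if b then 1 else 0) bs)

size : ∀ {m} → EdgeSet m → ℕ
size {m} S = sum (map (λ i → count (map (λ j → (toℕ i <ᵇ toℕ j) ∧ S i j) (allFin m))) (allFin m))

IsPM : ∀ {m} → Graph m → EdgeSet m → Set
IsPM {m} G M = M ⊆E G × (∀ i → ∃ λ j → M i j ≡ true × (∀ k → M i k ≡ true → k ≡ j))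

HasPM : ∀ {m} → Graph m → Set
HasPM G = ∃ λ M → IsPM G M

_─_ : ∀ {m} → Graph m → EdgeSet m → Graph m
adj   (G ─ S) i j = adj G i j ∧ not (S i j ∧ S j i)
sym   (G ─ S) i j rewrite Graph.sym G i j | BP.∧-comm (S i j) (S j i) = _≡_.refl
irref (G ─ S) i rewrite irref G i = _≡_.refl

UniquePM : ∀ {m} → Graph m → Set
UniquePM G = HasPM G × (∀ M₁ M₂ → IsPM G M₁ → IsPM G M₂ → M₁ ≈E M₂)

IsMinSize : ∀ {m} → (EdgeSet m → Set) → ℕ → Set
IsMinSize P k = (∃ λ S → P S × size S ≡ k) × (∀ S → P S → k ≤ size S)

AfCand : ∀ {m} → Graph m → EdgeSet m → EdgeSet m → Set
AfCand G M S = S ⊆E G × Disjoint S M × UniquePM (G ─ S)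

IsAfM : ∀ {m} → Graph m → EdgeSet m → ℕ → Set
IsAfM G M k = IsMinSize (AfCand G M) k

IsAf : ∀ {m} → Graph m → ℕ → Set
IsAf G k = (∃ λ M → IsPM G M × IsAfM G M k)
         × (∀ M b → IsPM G M → IsAfM G M b → b ≤ k)

GfCand : ∀ {m} → Graph m → EdgeSet m → Set
GfCand G S = S ⊆E G ×
  (∀ M₁ M₂ → IsPM G M₁ → IsPM G M₂ →
     (∀ i j → S i j ≡ true → M₁ i j ≡ M₂ i j) → M₁ ≈E M₂)

IsGf : ∀ {m} → Graph m → ℕ → Set
IsGf G k = IsMinSize (GfCand G) k

data Reach {m} (G : Graph m) (i : Fin m) : Fin m → Set where
  here : Reach G i i
  step : ∀ {j k} → Reach G i j → adj G j k ≡ true → Reach G i k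

Connected : ∀ {m} → Graph m → Set
Connected G = ∀ i j → Reach G i j

Bipartite : ∀ {m} → Graph m → Set
Bipartite {m} G = ∃ λ (c : Fin m → Bool) → ∀ i j → adj G i j ≡ true → c i ≢ c j

_≅_ : ∀ {m} → Graph m → Graph m → Set
_≅_ {m} G H = Σ (Fin m ↔ Fin m) λ f →
  ∀ i j → adj G i j ≡ adj H (Inverse.to f i) (Inverse.to f j)

side : ∀ {n} → Fin (n + n) → Bool
side {n} i = toℕ i <ᵇ n

K : (n : ℕ) → Graph (n + n)
adj   (K n) i j = side {n} i xor side {n} j
sym   (K n) i j = BP.xor-comm (side {n} i) (side {n} j)
irref (K n) i = BP.xor-same (side {n} i)

module Submission where

-- Write the rows and columns of a 0/1-matrix E for the colour classes, so that perfect matchings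
-- are permutations, and let T be the complement of a global forcing set.  A perfect matching N
-- with fewest edges outside T is the only perfect matching of T ∪ N, so some row meets T at most
-- once.  Replacing that row by the edge of a prescribed perfect matching M and deleting it
-- together with its M-partner turns T inductively into a graph with unique perfect matching M
-- and no fewer edges: this is Af ≤ gf.
-- A graph with a unique perfect matching has at most n(n+1)/2 edges, and the complement of a
-- spanning tree is a global forcing set; with e = |E| this gives Af ≥ e − n(n+1)/2 and
-- gf ≤ e − (2n−1), hence the upper bound.  If both are equalities, then relative to every perfect
-- matching E contains a half graph; its two extremal vertices are adjacent, since otherwise a
-- Hamiltonian cycle on the other vertices, with two pendant edges, would be the complement of a
-- global forcing set of size e − 2n.  Exchanging the two ends of the order then gives a full row
-- and a full column, and induction shows that E is complete.
-- For K_{n,n} the same descent, deleting a row and a column that each meet T at most once, gives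
-- |T| ≤ 2n−1, and af(M) = n(n−1)/2 for every M; so both estimates are attained.

open import Defs hiding (sym)
open import Data.Nat using (ℕ; zero; suc; _≤_; _<_; _*_; _∸_; _+_; _<ᵇ_; z≤n; s≤s)
open import Data.Nat.Properties
open import Data.Nat.Induction using (<-wellFounded)
open import Data.Nat.GeneralisedArithmetic using (fold; fold-+)
open import Data.Nat.Tactic.RingSolver using (solve-∀)
open import Data.Bool using (Bool; true; false; _∧_; _∨_; not; _xor_; if_then_else_)
import Data.Bool.Properties as BP
open import Data.Fin as Fin using (Fin; zero; suc; toℕ; fromℕ; punchIn; punchOut; _↑ˡ_; _↑ʳ_)
import Data.Fin.Properties as FP
open import Data.Fin.Permutation using (Permutation′; permutation; _⟨$⟩ʳ_; _⟨$⟩ˡ_; inverseˡ; inverseʳ; _∘ₚ_; flip; insert; remove; insert-punchIn; id; punchIn-permute; punchIn-permute′; transpose)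
open import Data.Fin.Induction using (<-weakInduction)
open import Data.Vec.Functional using (insertAt; _∷_)
open import Data.Vec.Functional.Properties using (insertAt-lookup; insertAt-punchIn)
open import Algebra.Properties.CommutativeMonoid.Sum +-0-commutativeMonoid using (sum; sum-cong-≗; sum-remove; sum-permute; ∑-distrib-+; ∑-comm)
import Data.Nat.ListAction as List
import Data.List as List hiding (sum)
open import Data.List.Properties using (map-tabulate; map-∘)
open import Algebra.Properties.CommutativeSemigroup +-commutativeSemigroup using (x∙yz≈y∙xz)
open import Data.Product using (Σ; ∃; ∃₂; _×_; _,_; proj₁; proj₂)
open import Data.Sum as Sum using (_⊎_; inj₁; inj₂)
open import Data.Sum.Properties using (inj₁-injective; inj₂-injective)
open import Data.Empty using (⊥; ⊥-elim)
open import Function.Base using (_∘_)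
open import Function.Bundles using (_⇔_; mk⇔; Inverse)
open import Induction.WellFounded using (Acc; acc)
open import Relation.Nullary using (¬_; Dec; yes; no; does; contradiction)
open import Relation.Nullary.Decidable using (_×-dec_; _⊎-dec_; ¬?; decidable-stable; dec-true; dec-false)
open import Relation.Binary.PropositionalEquality using (_≡_; _≢_; refl; sym; trans; cong; cong₂; subst; subst₂; module ≡-Reasoning)

-- Boolean vectors and matrices

true≢false : true ≢ false
true≢false ()

does-true : ∀ {P : Set} (P? : Dec P) → does P? ≡ true → P
does-true (yes p) _ = p

bit : Bool → ℕ
bit b = if b then 1 else 0

weight : ∀ {n} → (Fin n → Bool) → ℕ
weight f = sum (bit ∘ f)

Mat : ℕ → Set
Mat n = Fin n → Fin n → Bool

cnt : ∀ {n} → Mat n → ℕ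
cnt T = sum (weight ∘ T)

infix 4 _⊆M_
_⊆M_ : ∀ {n} → Mat n → Mat n → Set
T ⊆M E = ∀ i j → T i j ≡ true → E i j ≡ true

minor : ∀ {n} → Fin (suc n) → Fin (suc n) → Mat (suc n) → Mat n
minor r c T i j = T (punchIn r i) (punchIn c j)

sum-mono : ∀ {n} {f g : Fin n → ℕ} → (∀ i → f i ≤ g i) → sum f ≤ sum g
sum-mono {zero}  _   = z≤n
sum-mono {suc n} f≤g = +-mono-≤ (f≤g zero) (sum-mono (f≤g ∘ suc))

sum-mono-< : ∀ {n} {f g : Fin n → ℕ} → (∀ i → f i ≤ g i) → ∀ y → f y < g y → sum f < sum g
sum-mono-< f≤g zero    fy<gy = +-mono-<-≤ fy<gy (sum-mono (f≤g ∘ suc))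
sum-mono-< f≤g (suc y) fy<gy = +-mono-≤-< (f≤g zero) (sum-mono-< (f≤g ∘ suc) y fy<gy)

bit-mono : ∀ {a b} → (a ≡ true → b ≡ true) → bit a ≤ bit b
bit-mono {false}        _   = z≤n
bit-mono {true} {true}  _   = ≤-refl
bit-mono {true} {false} a⇒b = contradiction (sym (a⇒b refl)) true≢false

weight-mono : ∀ {n} {f g : Fin n → Bool} → (∀ i → f i ≡ true → g i ≡ true) → weight f ≤ weight g
weight-mono f⇒g = sum-mono λ i → bit-mono (f⇒g i)

weight-mono-< : ∀ {n} {f g : Fin n → Bool} → (∀ i → f i ≡ true → g i ≡ true) →
  ∀ y → f y ≡ false → g y ≡ true → weight f < weight g
weight-mono-< {f = f} {g} f⇒g y fy gy = sum-mono-< (λ i → bit-mono (f⇒g i)) y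
  (subst₂ (λ a b → bit a < bit b) (sym fy) (sym gy) (s≤s z≤n))

weight≤n : ∀ {n} (f : Fin n → Bool) → weight f ≤ n
weight≤n {zero}  f = z≤n
weight≤n {suc n} f = +-mono-≤ (bit-mono {f zero} {true} (λ _ → refl)) (weight≤n (f ∘ suc))

weight-full : ∀ {n} {f : Fin n → Bool} → n ≤ weight f → ∀ i → f i ≡ true
weight-full {f = f} n≤w i with f i in eq
... | true  = refl
... | false = contradiction
  (≤-trans (weight-mono-< {g = λ _ → true} (λ _ _ → refl) i eq refl) (weight≤n _)) (≤⇒≯ n≤w)

weight-pos : ∀ {n} (f : Fin n → Bool) c → f c ≡ true → 1 ≤ weight f
weight-pos f zero    fc rewrite fc = s≤s z≤n
weight-pos f (suc c) fc = ≤-trans (weight-pos (f ∘ suc) c fc) (m≤n+m _ (bit (f zero)))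

weight-none : ∀ {n} {f : Fin n → Bool} → (∀ i → f i ≡ false) → weight f ≡ 0
weight-none {zero}  _ = refl
weight-none {suc n} f≡0 rewrite f≡0 zero = weight-none (f≡0 ∘ suc)

weight-single : ∀ {n} (f : Fin n → Bool) c → (∀ j → f j ≡ true → j ≡ c) → weight f ≤ 1
weight-single {suc n} f c f⇒c rewrite sum-remove {i = c} (bit ∘ f)
  | weight-none {f = f ∘ punchIn c} (λ i → BP.¬-not (FP.punchInᵢ≢i c i ∘ f⇒c _))
  | +-identityʳ (bit (f c)) = bit-mono {f c} {true} (λ _ → refl)

-- The corner is charged to row `r`, so that a bound on this row leaves only `n` column entries to
-- estimate.
cnt-split : ∀ {n} r c (T : Mat (suc n)) →
  cnt T ≡ weight (T r) + (weight (λ i → T (punchIn r i) c) + cnt (minor r c T))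
cnt-split r c T = trans (sum-remove {i = r} (weight ∘ T))
  (cong (weight (T r) +_)
    (trans (sum-cong-≗ λ i → sum-remove {i = c} (bit ∘ T (punchIn r i)))
           (∑-distrib-+ (λ i → bit (T (punchIn r i) c)) _)))

cnt-minus : ∀ {n} {E H : Mat n} → H ⊆M E → cnt H + cnt (λ i j → E i j ∧ not (H i j)) ≡ cnt E
cnt-minus {E = E} {H} H⊆E = trans (sym (∑-distrib-+ (weight ∘ H) (λ i → weight (λ j → E i j ∧ not (H i j))))) (sum-cong-≗ λ i →
  trans (sym (∑-distrib-+ (bit ∘ H i) (λ j → bit (E i j ∧ not (H i j))))) (sum-cong-≗ λ j → entry (H⊆E i j)))
  where
  entry : ∀ {h e} → (h ≡ true → e ≡ true) → bit h + bit (e ∧ not h) ≡ bit e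
  entry {false} {false} _   = refl
  entry {false} {true}  _   = refl
  entry {true}  {true}  _   = refl
  entry {true}  {false} h⇒e = contradiction (sym (h⇒e refl)) true≢false

-- Perfect matchings as permutations

infix 4 _⊑_
_⊑_ : ∀ {n} → Permutation′ n → Mat n → Set
π ⊑ E = ∀ i → E i (π ⟨$⟩ʳ i) ≡ true

-- One-sided; both directions together say that the symmetric difference of the two matchings lies
-- in `T`, so that they have the same trace on its complement.
AgreeOff : ∀ {n} → Mat n → Permutation′ n → Permutation′ n → Set
AgreeOff T π σ = ∀ i → T i (π ⟨$⟩ʳ i) ≡ false → σ ⟨$⟩ʳ i ≡ π ⟨$⟩ʳ i

-- The complement of T in E is a global forcing set of E.
CoForcing : ∀ {n} → Mat n → Mat n → Set
CoForcing E T = ∀ π σ → π ⊑ E → σ ⊑ E → AgreeOff T π σ → AgreeOff T σ π →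
  ∀ i → π ⟨$⟩ʳ i ≡ σ ⟨$⟩ʳ i

Unique : ∀ {n} → Mat n → Permutation′ n → Set
Unique H π = ∀ σ → σ ⊑ H → ∀ i → σ ⟨$⟩ʳ i ≡ π ⟨$⟩ʳ i

Permutation-injective : ∀ {n} (π : Permutation′ n) {i j} → π ⟨$⟩ʳ i ≡ π ⟨$⟩ʳ j → i ≡ j
Permutation-injective π eq = trans (sym (inverseˡ π)) (trans (cong (π ⟨$⟩ˡ_) eq) (inverseˡ π))

-- f acts as a permutation on the points z with f^d z = z, and by the pigeonhole
-- principle this set is inhabited for some d ≥ 1.
partial-cycle : ∀ {n} (f : Fin (suc n) → Fin (suc n)) →
  Σ (Permutation′ (suc n)) λ ρ → (∃ λ y → ρ ⟨$⟩ʳ y ≡ f y) ×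
    (∀ x → ρ ⟨$⟩ʳ x ≡ x ⊎ ρ ⟨$⟩ʳ x ≡ f x)
partial-cycle {n} f with FP.pigeonhole (n<1+n (suc n)) (λ k → fold zero f (toℕ k))
... | i , j , i<j , fⁱ≡fʲ with m≤n⇒∃[o]m+o≡n i<j
-- Here `d` is one less than the distance of the two repeated times: the period `suc d` is positive,
-- and `fold z f d` inverts `f` on periodic points.
... | d , 1+i+d≡j = permutation to from to∘from from∘to , (y , to-y) , to-cases
  where
  swap-fold : ∀ x k l → fold (fold x f l) f k ≡ fold (fold x f k) f l
  swap-fold x k l = trans (sym (fold-+ x f k)) (trans (cong (fold x f) (+-comm k l)) (fold-+ x f l))
  y = fold zero f (toℕ i)
  Periodic : Fin (suc n) → Set
  Periodic z = fold z f (suc d) ≡ z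
  y-periodic : Periodic y
  y-periodic = trans (sym (fold-+ zero f (suc d)))
    (trans (cong (fold zero f) (trans (cong suc (+-comm d (toℕ i))) 1+i+d≡j)) (sym fⁱ≡fʲ))
  fold-periodic : ∀ k {z} → Periodic z → Periodic (fold z f k)
  fold-periodic k {z} p = trans (swap-fold z (suc d) k) (cong (λ w → fold w f k) p)
  to from : Fin (suc n) → Fin (suc n)
  to z with fold z f (suc d) FP.≟ z
  ... | yes _ = f z
  ... | no _  = z
  from z with fold z f (suc d) FP.≟ z
  ... | yes _ = fold z f d
  ... | no _  = z
  to∘from : ∀ z → to (from z) ≡ z
  to∘from z with fold z f (suc d) FP.≟ z
  to∘from z | yes p with fold (fold z f d) f (suc d) FP.≟ fold z f d
  ... | yes _ = p
  ... | no ¬q = contradiction (fold-periodic d p) ¬q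
  to∘from z | no ¬p with fold z f (suc d) FP.≟ z
  ... | yes p = contradiction p ¬p
  ... | no _  = refl
  from∘to : ∀ z → from (to z) ≡ z
  from∘to z with fold z f (suc d) FP.≟ z
  from∘to z | yes p with fold (f z) f (suc d) FP.≟ f z
  ... | yes _ = trans (swap-fold z d 1) p
  ... | no ¬q = contradiction (fold-periodic 1 p) ¬q
  from∘to z | no ¬p with fold z f (suc d) FP.≟ z
  ... | yes p = contradiction p ¬p
  ... | no _  = refl
  to-y : to y ≡ f y
  to-y with fold y f (suc d) FP.≟ y
  ... | yes _ = refl
  ... | no ¬p = contradiction y-periodic ¬p
  to-cases : ∀ x → to x ≡ x ⊎ to x ≡ f x
  to-cases x with fold x f (suc d) FP.≟ x
  ... | yes _ = inj₂ refl
  ... | no _  = inj₁ refl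

-- A perfect matching N with as few edges as possible outside T is the only perfect
-- matching of T ∪ N: if every row had a T-edge avoiding N, following such edges
-- would give an alternating cycle along which N could be exchanged into T.
pendant-row : ∀ {n} (E T : Mat (suc n)) → T ⊆M E → CoForcing E T → ∀ N → N ⊑ E →
  ∃₂ λ r c → ∀ j → T r j ≡ true → j ≡ c
pendant-row {n} E T T⊆E cf N N⊑E = go N N⊑E (<-wellFounded _)
  where
  outside : Permutation′ (suc n) → Fin (suc n) → Bool
  outside N i = not (T i (N ⟨$⟩ʳ i))
  go : ∀ N → N ⊑ E → Acc _<_ (weight (outside N)) → ∃₂ λ r c → ∀ j → T r j ≡ true → j ≡ c
  go N N⊑E (acc rec) with FP.any? (λ r → ¬? (FP.any? (λ j → (T r j BP.≟ true) ×-dec ¬? (j FP.≟ N ⟨$⟩ʳ r))))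
  ... | yes (r , none) = r , N ⟨$⟩ʳ r , λ j t →
    decidable-stable (j FP.≟ N ⟨$⟩ʳ r) (λ j≢ → none (j , t , j≢))
  ... | no all-rows = improve (partial-cycle f)
    where
    exit : ∀ r → ∃ λ j → T r j ≡ true × j ≢ N ⟨$⟩ʳ r
    exit r = decidable-stable (FP.any? (λ j → (T r j BP.≟ true) ×-dec ¬? (j FP.≟ N ⟨$⟩ʳ r)))
      (λ none → all-rows (r , none))
    f : Fin (suc n) → Fin (suc n)
    f r = N ⟨$⟩ˡ proj₁ (exit r)
    Nf : ∀ r → N ⟨$⟩ʳ f r ≡ proj₁ (exit r)
    Nf r = inverseʳ N
    T-f : ∀ r → T r (N ⟨$⟩ʳ f r) ≡ true
    T-f r = trans (cong (T r) (Nf r)) (proj₁ (proj₂ (exit r)))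
    improve : (Σ (Permutation′ (suc n)) λ ρ → (∃ λ y → ρ ⟨$⟩ʳ y ≡ f y) ×
      (∀ x → ρ ⟨$⟩ʳ x ≡ x ⊎ ρ ⟨$⟩ʳ x ≡ f x)) → ∃₂ λ r c → ∀ j → T r j ≡ true → j ≡ c
    improve (ρ , (y , ρy) , ρ-cases) = decide
      (FP.any? λ i → (T i (N′ ⟨$⟩ʳ i) BP.≟ true) ×-dec (T i (N ⟨$⟩ʳ i) BP.≟ false))
      where
      N′ = ρ ∘ₚ N
      N′⊑E : N′ ⊑ E
      N′⊑E i with ρ-cases i
      ... | inj₁ eq = trans (cong (λ z → E i (N ⟨$⟩ʳ z)) eq) (N⊑E i)
      ... | inj₂ eq = trans (cong (λ z → E i (N ⟨$⟩ʳ z)) eq) (T⊆E i _ (T-f i))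
      agree : AgreeOff T N′ N
      agree i off with ρ-cases i
      ... | inj₁ eq = cong (N ⟨$⟩ʳ_) (sym eq)
      ... | inj₂ eq = contradiction
        (trans (sym (trans (cong (λ z → T i (N ⟨$⟩ʳ z)) eq) (T-f i))) off) true≢false
      decide : Dec (∃ λ i → T i (N′ ⟨$⟩ʳ i) ≡ true × T i (N ⟨$⟩ʳ i) ≡ false) →
        ∃₂ λ r c → ∀ j → T r j ≡ true → j ≡ c
      decide (yes (i , in′ , out)) = go N′ N′⊑E (rec
        (weight-mono-< fewer i (cong not in′) (cong not out)))
        where
        fewer : ∀ i → outside N′ i ≡ true → outside N i ≡ true
        fewer i o = trans (cong (not ∘ T i) (agree i (BP.not-injective o))) o
      -- If no row moves into `T`, the matchings `N` and `N′` agree off `T` in both directions and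
      -- hence coincide, although `ρ` moves `y`.
      decide (no none) = contradiction
        (trans (sym (Nf y)) (trans (cong (N ⟨$⟩ʳ_) (sym ρy)) (sym (cf N N′ N⊑E N′⊑E agree′ agree y))))
        (proj₂ (proj₂ (exit y)))
        where
        agree′ : AgreeOff T N N′
        agree′ i off = sym (agree i (BP.¬-not (λ in′ → none (i , in′ , off))))

-- Deleting a row and a column

data At {n} (r : Fin (suc n)) : Fin (suc n) → Set where
  at  : At r r
  off : ∀ k → At r (punchIn r k)

at? : ∀ {n} (r i : Fin (suc n)) → At r i
at? r i with r FP.≟ i
... | yes refl = at
... | no r≢i   = subst (At r) (FP.punchIn-punchOut r≢i) (off (punchOut r≢i))

insert-at : ∀ {n} r c (π : Permutation′ n) → insert r c π ⟨$⟩ʳ r ≡ c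
insert-at r c π with r FP.≟ r
... | yes _  = refl
... | no r≢r = contradiction refl r≢r

insert-⊑ : ∀ {n} (E : Mat (suc n)) r c (π : Permutation′ n) → E r c ≡ true →
  π ⊑ minor r c E → insert r c π ⊑ E
insert-⊑ E r c π rc π⊑ i with at? r i
... | at    = trans (cong (E r) (insert-at r c π)) rc
... | off k = trans (cong (E (punchIn r k)) (insert-punchIn r c π k)) (π⊑ k)

insert-agree : ∀ {n} (T : Mat (suc n)) r c (π σ : Permutation′ n) →
  AgreeOff (minor r c T) π σ → AgreeOff T (insert r c π) (insert r c σ)
insert-agree T r c π σ agree i out with at? r i
... | at    = trans (insert-at r c σ) (sym (insert-at r c π))
... | off k = trans (insert-punchIn r c σ k) (trans
  (cong (punchIn c) (agree k (trans (cong (T (punchIn r k)) (sym (insert-punchIn r c π k))) out)))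
  (sym (insert-punchIn r c π k)))

-- Adding the edge `(r , c)` to two matchings of the minor creates no new difference, whether or not
-- this edge lies in `T`.
minor-coforcing : ∀ {n} (E T : Mat (suc n)) r c → E r c ≡ true → CoForcing E T →
  CoForcing (minor r c E) (minor r c T)
minor-coforcing E T r c rc cf π σ π⊑ σ⊑ a b k = FP.punchIn-injective c _ _
  (trans (sym (insert-punchIn r c π k)) (trans
    (cf (insert r c π) (insert r c σ) (insert-⊑ E r c π rc π⊑) (insert-⊑ E r c σ rc σ⊑)
      (insert-agree T r c π σ a) (insert-agree T r c σ π b) (punchIn r k))
    (insert-punchIn r c σ k)))

remove-⊑ : ∀ {n} (H : Mat (suc n)) {r c} (σ : Permutation′ (suc n)) → σ ⊑ H → σ ⟨$⟩ʳ r ≡ c →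
  remove r σ ⊑ minor r c H
remove-⊑ H {r} σ σ⊑ refl k =
  trans (cong (H (punchIn r k)) (sym (punchIn-permute σ r k))) (σ⊑ (punchIn r k))

-- The matrix with minor H at (r , c), column c given by col, and (r , c) as its only entry in row r.
bordered : ∀ {n} → Fin (suc n) → Fin (suc n) → (Fin n → Bool) → Mat n → Mat (suc n)
bordered r c col H = insertAt (λ i → insertAt (H i) c (col i)) r (insertAt (λ _ → false) c true)

module _ {n} (r c : Fin (suc n)) (col : Fin n → Bool) (H : Mat n) where

  private
    first : Fin (suc n) → Bool
    first = insertAt (λ _ → false) c true
    rest : Fin n → Fin (suc n) → Bool
    rest i = insertAt (H i) c (col i)

  bordered-corner : bordered r c col H r c ≡ true
  bordered-corner = trans (cong (λ v → v c) (insertAt-lookup rest r first)) (insertAt-lookup _ c true)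

  bordered-row : ∀ j → bordered r c col H r (punchIn c j) ≡ false
  bordered-row j = trans (cong (λ v → v (punchIn c j)) (insertAt-lookup rest r first)) (insertAt-punchIn _ c true j)

  bordered-col : ∀ i → bordered r c col H (punchIn r i) c ≡ col i
  bordered-col i = trans (cong (λ v → v c) (insertAt-punchIn rest r first i)) (insertAt-lookup (H i) c (col i))

  bordered-minor : ∀ i j → bordered r c col H (punchIn r i) (punchIn c j) ≡ H i j
  bordered-minor i j = trans (cong (λ v → v (punchIn c j)) (insertAt-punchIn rest r first i)) (insertAt-punchIn (H i) c (col i) j)

  cnt-bordered : 1 + (weight col + cnt H) ≤ cnt (bordered r c col H)
  cnt-bordered = ≤-trans
    (+-mono-≤ (weight-pos (bordered r c col H r) c bordered-corner)
      (≤-reflexive (cong₂ _+_ (sum-cong-≗ {n} λ i → cong bit (sym (bordered-col i)))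
        (sum-cong-≗ {n} λ i → sum-cong-≗ {n} λ j → cong bit (sym (bordered-minor i j))))))
    (≤-reflexive (sym (cnt-split r c (bordered r c col H))))

bordered-⊑ : ∀ {n} r col (H : Mat n) (π : Permutation′ (suc n)) → remove r π ⊑ H →
  π ⊑ bordered r (π ⟨$⟩ʳ r) col H
bordered-⊑ r col H π π⊑ i with at? r i
... | at    = bordered-corner r (π ⟨$⟩ʳ r) col H
... | off k = trans (cong (bordered r (π ⟨$⟩ʳ r) col H (punchIn r k)) (punchIn-permute π r k))
  (trans (bordered-minor r (π ⟨$⟩ʳ r) col H k _) (π⊑ k))

-- Row `r` has a single entry and forces the edge `(r , π r)`; what remains is a perfect matching of
-- `H`, whatever `col` contains.
bordered-unique : ∀ {n} r col (H : Mat n) (π : Permutation′ (suc n)) → Unique H (remove r π) →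
  Unique (bordered r (π ⟨$⟩ʳ r) col H) π
bordered-unique r col H π uniq σ σ⊑ = λ i → agree i (at? r i)
  where
  B = bordered r (π ⟨$⟩ʳ r) col H
  only : ∀ j → At (π ⟨$⟩ʳ r) j → B r j ≡ true → j ≡ π ⟨$⟩ʳ r
  only _ at      _ = refl
  only _ (off k) t = contradiction (trans (sym t) (bordered-row r (π ⟨$⟩ʳ r) col H k)) true≢false
  same : σ ⟨$⟩ʳ r ≡ π ⟨$⟩ʳ r
  same = only _ (at? _ _) (σ⊑ r)
  agree : ∀ i → At r i → σ ⟨$⟩ʳ i ≡ π ⟨$⟩ʳ i
  agree _ at      = same
  agree _ (off k) = trans (punchIn-permute σ r k) (trans (cong₂ punchIn same (uniq (remove r σ)
    (λ i → trans (sym (bordered-minor r (π ⟨$⟩ʳ r) col H i _)) (remove-⊑ B σ σ⊑ same i)) k))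
    (sym (punchIn-permute π r k)))

-- A row meeting T at most once can be replaced by the single edge of π in that row,
-- without loss of edges.
unique-of-coforcing : ∀ {n} (E T : Mat n) (π : Permutation′ n) → T ⊆M E → π ⊑ E → CoForcing E T →
  ∃ λ H → H ⊆M E × π ⊑ H × Unique H π × cnt T ≤ cnt H
unique-of-coforcing {zero} E T π T⊆E π⊑E cf = T , T⊆E , (λ ()) , (λ _ _ ()) , ≤-refl
unique-of-coforcing {suc n} E T π T⊆E π⊑E cf
  with r , _ , single ← pendant-row E T T⊆E cf π π⊑E
  with H′ , H′⊆ , π⊑H′ , uniq , le ← unique-of-coforcing (minor r (π ⟨$⟩ʳ r) E)
         (minor r (π ⟨$⟩ʳ r) T) (remove r π) (λ i j → T⊆E _ _) (remove-⊑ E π π⊑E refl)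
         (minor-coforcing E T r _ (π⊑E r) cf)
  = H , H⊆E , bordered-⊑ r col H′ π π⊑H′ , bordered-unique r col H′ π uniq , bound
  where
  c = π ⟨$⟩ʳ r
  col : Fin n → Bool
  col i = T (punchIn r i) c
  H = bordered r c col H′
  H⊆E : H ⊆M E
  H⊆E i j t with at? r i | at? c j
  ... | at    | at    = π⊑E r
  ... | at    | off l = contradiction (trans (sym t) (bordered-row r c col H′ l)) true≢false
  ... | off k | at    = T⊆E _ _ (trans (sym (bordered-col r c col H′ k)) t)
  ... | off k | off l = H′⊆ k l (trans (sym (bordered-minor r c col H′ k l)) t)
  bound : cnt T ≤ cnt H
  bound = ≤-trans (≤-reflexive (cnt-split r c T)) (≤-trans
    (+-mono-≤ (weight-single (T r) _ single) (+-monoʳ-≤ (weight col) le)) (cnt-bordered r c col H′))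

-- Extremal sizes of bipartite graphs with a unique perfect matching

-- Bordering with a full column at every stage yields 1 + 2 + ... + n edges; the count is doubled to
-- avoid division.
triangular : ∀ {n} (π : Permutation′ n) →
  ∃ λ H → π ⊑ H × Unique H π × n * suc n ≤ 2 * cnt H
triangular {zero}  π = (λ ()) , (λ ()) , (λ _ _ ()) , z≤n
triangular {suc n} π with H′ , π⊑H′ , uniq , le ← triangular (remove zero π) =
  bordered zero c col H′ , bordered-⊑ zero col H′ π π⊑H′ , bordered-unique zero col H′ π uniq ,
  (begin
    suc n * suc (suc n)                        ≡⟨ expand n ⟩
    2 * (1 + n) + n * suc n                    ≤⟨ +-mono-≤ (*-monoʳ-≤ 2 (+-monoʳ-≤ 1 (all-true n))) le ⟩
    2 * (1 + weight col) + 2 * cnt H′          ≡⟨ *-distribˡ-+ 2 (1 + weight col) (cnt H′) ⟨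
    2 * (1 + (weight col + cnt H′))            ≤⟨ *-monoʳ-≤ 2 (cnt-bordered zero c col H′) ⟩
    2 * cnt (bordered zero c col H′)           ∎)
  where
  open ≤-Reasoning
  c = π ⟨$⟩ʳ zero
  col : Fin n → Bool
  col _ = true
  expand : ∀ n → suc n * suc (suc n) ≡ 2 * (1 + n) + n * suc n
  expand = solve-∀
  all-true : ∀ n → n ≤ weight {n} (λ _ → true)
  all-true zero    = z≤n
  all-true (suc n) = s≤s (all-true n)

-- Makes `pendant-row` applicable with `H` in the role of both `E` and `T`.
unique⇒coforcing : ∀ {n} (H : Mat n) π → Unique H π → CoForcing H H
unique⇒coforcing H π uniq σ τ σ⊑ τ⊑ _ _ i = trans (uniq σ σ⊑ i) (sym (uniq τ τ⊑ i))

minor-unique : ∀ {n} (H : Mat (suc n)) (π : Permutation′ (suc n)) r → π ⊑ H → Unique H π →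
  Unique (minor r (π ⟨$⟩ʳ r) H) (remove r π)
minor-unique H π r π⊑ uniq σ σ⊑ k = FP.punchIn-injective (π ⟨$⟩ʳ r) _ _
  (trans (sym (insert-punchIn r _ σ k)) (trans (uniq (insert r _ σ) (insert-⊑ H r _ σ (π⊑ r) σ⊑) (punchIn r k))
    (punchIn-permute π r k)))

-- A pendant row contributes at most one edge and the rest of its partner's column at most n - 1;
-- the minor keeps a unique perfect matching.
unique-size : ∀ {n} (H : Mat n) (π : Permutation′ n) → π ⊑ H → Unique H π → 2 * cnt H ≤ n * suc n
unique-size {zero}  H π π⊑ uniq = z≤n
unique-size {suc n} H π π⊑ uniq with r , _ , single ← pendant-row H H (λ _ _ t → t) (unique⇒coforcing H π uniq) π π⊑ = begin
    2 * cnt H                                     ≡⟨ cong (2 *_) (cnt-split r c H) ⟩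
    2 * (weight (H r) + (weight col + cnt H′))    ≤⟨ *-monoʳ-≤ 2 (+-mono-≤ (weight-single (H r) _ single) (+-monoˡ-≤ (cnt H′) (weight≤n col))) ⟩
    2 * (1 + (n + cnt H′))                        ≡⟨ expand n (cnt H′) ⟩
    2 + 2 * n + 2 * cnt H′                        ≤⟨ +-monoʳ-≤ (2 + 2 * n) (unique-size (minor r _ H) (remove r π) (remove-⊑ H π π⊑ refl) (minor-unique H π r π⊑ uniq)) ⟩
    2 + 2 * n + n * suc n                         ≡⟨ collect n ⟩
    suc n * suc (suc n)                           ∎
  where
  open ≤-Reasoning
  c = π ⟨$⟩ʳ r
  col : Fin n → Bool
  col i = H (punchIn r i) c
  H′ = minor r c H
  expand : ∀ n m → 2 * (1 + (n + m)) ≡ 2 + 2 * n + 2 * m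
  expand = solve-∀
  collect : ∀ n → 2 + 2 * n + n * suc n ≡ suc n * suc (suc n)
  collect = solve-∀

-- E contains the lower triangle when its rows are ordered by ρ and its columns by π ∘ ρ.
Half : ∀ {n} → Mat n → Permutation′ n → Permutation′ n → Set
Half E π ρ = ∀ i j → j Fin.≤ i → E (ρ ⟨$⟩ʳ i) (π ⟨$⟩ʳ (ρ ⟨$⟩ʳ j)) ≡ true

-- Equality in `unique-size` must hold at every stage of its induction, which makes each deleted
-- column full.
unique-extremal : ∀ {n} (H : Mat n) (π : Permutation′ n) → π ⊑ H → Unique H π → n * suc n ≤ 2 * cnt H →
  ∃ (Half H π)
unique-extremal {zero}  H π π⊑ uniq large = π , λ ()
unique-extremal {suc n} H π π⊑ uniq large
  with r , _ , single ← pendant-row H H (λ _ _ t → t) (unique⇒coforcing H π uniq) π π⊑ = extend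
    (unique-extremal (minor r _ H) (remove r π) (remove-⊑ H π π⊑ refl) (minor-unique H π r π⊑ uniq) large-minor)
  where
  c = π ⟨$⟩ʳ r
  col : Fin n → Bool
  col i = H (punchIn r i) c
  m = cnt (minor r c H)
  expand : ∀ n → suc n * suc (suc n) ≡ (2 + 2 * n) + n * suc n
  expand = solve-∀
  collect : ∀ w m → 2 * (1 + (w + m)) ≡ (2 + 2 * w) + 2 * m
  collect = solve-∀
  total : (2 + 2 * n) + n * suc n ≤ (2 + 2 * weight col) + 2 * m
  total = begin
    (2 + 2 * n) + n * suc n               ≡⟨ expand n ⟨
    suc n * suc (suc n)                   ≤⟨ large ⟩
    2 * cnt H                             ≡⟨ cong (2 *_) (cnt-split r c H) ⟩
    2 * (weight (H r) + (weight col + m)) ≤⟨ *-monoʳ-≤ 2 (+-monoˡ-≤ _ (weight-single (H r) _ single)) ⟩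
    2 * (1 + (weight col + m))            ≡⟨ collect (weight col) m ⟩
    (2 + 2 * weight col) + 2 * m          ∎
    where open ≤-Reasoning
  large-minor : n * suc n ≤ 2 * m
  large-minor = +-cancelˡ-≤ (2 + 2 * n) _ _
    (≤-trans total (+-monoˡ-≤ (2 * m) (+-monoʳ-≤ 2 (*-monoʳ-≤ 2 (weight≤n col)))))
  full-col : ∀ i → col i ≡ true
  -- The minor has at most n(n+1)/2 edges, so the whole remainder has to come from this column.
  full-col = weight-full (*-cancelˡ-≤ 2 (+-cancelˡ-≤ 2 _ _ (+-cancelʳ-≤ (n * suc n) _ _
    (≤-trans total (+-monoʳ-≤ (2 + 2 * weight col)
      (unique-size (minor r _ H) (remove r π) (remove-⊑ H π π⊑ refl) (minor-unique H π r π⊑ uniq)))))))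
  extend : ∃ (Half (minor r c H) (remove r π)) → ∃ (Half H π)
  -- The pendant row comes first: its row needs only the matching edge, and its full column serves
  -- all later rows.
  extend (ρ′ , half) = insert zero r ρ′ , λ where
    zero    zero    _         → π⊑ r
    (suc i) zero    _         → full-col (ρ′ ⟨$⟩ʳ i)
    (suc i) (suc j) (s≤s j≤i) → trans (cong (H _) (punchIn-permute π r _)) (half i j j≤i)

-- A largest co-forcing set of the complete bipartite graph

complete : ∀ n → Mat n
complete n _ _ = true

-- Transposition replaces matchings by their inverses, all of which lie in the complete matrix.
transpose-coforcing : ∀ {n} (T : Mat n) → CoForcing (complete n) T → CoForcing (complete n) (λ i j → T j i)
transpose-coforcing T cf π σ _ _ a b i = begin
  π ⟨$⟩ʳ i                              ≡⟨ cong (π ⟨$⟩ʳ_) (inverseˡ σ) ⟨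
  π ⟨$⟩ʳ (σ ⟨$⟩ˡ (σ ⟨$⟩ʳ i))              ≡⟨ cong (π ⟨$⟩ʳ_) (cf (flip π) (flip σ) (λ _ → refl) (λ _ → refl) (back π σ a) (back σ π b) (σ ⟨$⟩ʳ i)) ⟨
  π ⟨$⟩ʳ (π ⟨$⟩ˡ (σ ⟨$⟩ʳ i))              ≡⟨ inverseʳ π ⟩
  σ ⟨$⟩ʳ i                              ∎
  where
  open ≡-Reasoning
  back : ∀ π σ → AgreeOff (λ i j → T j i) π σ → AgreeOff T (flip π) (flip σ)
  back π σ a j out = trans (cong (σ ⟨$⟩ˡ_) (sym (trans (a (π ⟨$⟩ˡ j)
    (trans (cong (λ z → T z (π ⟨$⟩ˡ j)) (inverseʳ π)) out)) (inverseʳ π)))) (inverseˡ σ)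

-- By completeness a pendant row and a pendant column always cross in an edge, so both can be
-- deleted together. Each step loses at most two entries of `T`, and order one has at most one.
complete-coforcing-size : ∀ {n} (T : Mat (suc n)) → CoForcing (complete (suc n)) T → cnt T + 1 ≤ 2 * suc n
complete-coforcing-size {zero} T cf with T zero zero
... | true  = ≤-refl
... | false = s≤s z≤n
complete-coforcing-size {suc n} T cf
  with r , _ , single-row ← pendant-row (complete _) T (λ _ _ _ → refl) cf id (λ _ → refl)
  with c , _ , single-col ← pendant-row (complete _) (λ i j → T j i) (λ _ _ _ → refl) (transpose-coforcing T cf) id (λ _ → refl)
  = begin
    cnt T + 1                                               ≡⟨ cong (_+ 1) (cnt-split r c T) ⟩
    weight (T r) + (weight (λ i → T (punchIn r i) c) + m) + 1
      ≤⟨ +-monoˡ-≤ 1 (+-mono-≤ (weight-single (T r) _ single-row) (+-monoˡ-≤ m col≤1)) ⟩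
    1 + (1 + m) + 1                                         ≤⟨ +-monoʳ-≤ 2 (complete-coforcing-size (minor r c T) (minor-coforcing (complete _) T r c refl cf)) ⟩
    2 + 2 * suc n                                           ≡⟨ *-suc 2 (suc n) ⟨
    2 * suc (suc n)                                         ∎
  where
  open ≤-Reasoning
  m = cnt (minor r c T)
  col≤1 : weight (λ i → T (punchIn r i) c) ≤ 1
  col≤1 = ≤-trans (m≤n+m _ (bit (T r c)))
    (≤-trans (≤-reflexive (sym (sum-remove {i = r} (λ i → bit (T i c))))) (weight-single (λ i → T i c) _ single-col))

-- Completeness from the ordering of every perfect matching

-- Double negation, since a minimum anti-forcing set of an arbitrary perfect matching is not
-- found constructively; adjacency is decidable, so this suffices.
Orderable : ∀ {n} → Mat n → Set
Orderable E = ∀ π → π ⊑ E → ¬ ¬ ∃ (Half E π)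

-- The first row and the last column are the vertices of degree one in the half graph; this asks for
-- the edge between them.
Closing : ∀ {n} → Mat (suc n) → Set
Closing {n} E = ∀ π ρ → π ⊑ E → Half E π ρ → E (ρ ⟨$⟩ʳ zero) (π ⟨$⟩ʳ (ρ ⟨$⟩ʳ fromℕ n)) ≡ true

module _ {n} (E : Mat (suc (suc n))) (r c : Fin (suc (suc n))) where

  -- Dropping `r` from the order found for the matching extended by `(r , c)` preserves the order of
  -- the other pairs.
  minor-orderable : E r c ≡ true → Orderable E → Orderable (minor r c E)
  minor-orderable rc ord π π⊑ none = ord (insert r c π) (insert-⊑ E r c π rc π⊑) λ (ρ , half) →
    none (remove (ρ ⟨$⟩ˡ r) ρ , λ i j j≤i → trans
      (cong₂ E (sym (punchIn-permute′ ρ r i)) (trans (sym (insert-punchIn r c π _))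
        (cong (insert r c π ⟨$⟩ʳ_) (sym (punchIn-permute′ ρ r j)))))
      (half _ _ (FP.punchIn-mono-≤ (ρ ⟨$⟩ˡ r) j i j≤i)))

  -- The pair (r , c) is inserted as second in the order, so that the first and last pairs persist.
  minor-closing : (∀ j → E r j ≡ true) → (∀ i → E i c ≡ true) → Closing E → Closing (minor r c E)
  minor-closing row col closing π ρ π⊑ half = at-ends n refl
    where
    s = suc zero
    π⁺ = insert r c π
    ρ⁺ = insert s r ρ
    π⁺ρ⁺ : ∀ k → π⁺ ⟨$⟩ʳ (ρ⁺ ⟨$⟩ʳ punchIn s k) ≡ punchIn c (π ⟨$⟩ʳ (ρ ⟨$⟩ʳ k))
    π⁺ρ⁺ k = trans (cong (π⁺ ⟨$⟩ʳ_) (insert-punchIn s r ρ k)) (insert-punchIn r c π (ρ ⟨$⟩ʳ k))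
    half⁺ : Half E π⁺ ρ⁺
    half⁺ i j j≤i with at? s i | at? s j
    ... | at    | _  = trans (cong (λ z → E z (π⁺ ⟨$⟩ʳ (ρ⁺ ⟨$⟩ʳ j))) (insert-at s r ρ)) (row _)
    ... | off k | at = trans (cong (E (ρ⁺ ⟨$⟩ʳ punchIn s k))
      (trans (cong (π⁺ ⟨$⟩ʳ_) (insert-at s r ρ)) (insert-at r c π))) (col _)
    ... | off k | off l = trans (cong₂ E (insert-punchIn s r ρ k) (π⁺ρ⁺ l))
      (half k l (FP.punchIn-cancel-≤ s l k j≤i))
    -- From order two on, `punchIn s` fixes both ends of the order; in order one the ends coincide
    -- and their edge belongs to the matching.
    at-ends : ∀ m → m ≡ n →
      E (punchIn r (ρ ⟨$⟩ʳ zero)) (punchIn c (π ⟨$⟩ʳ (ρ ⟨$⟩ʳ fromℕ n))) ≡ true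
    at-ends zero    refl = π⊑ (ρ ⟨$⟩ʳ zero)
    at-ends (suc m) refl = trans
      (cong₂ E (sym (insert-punchIn s r ρ zero)) (sym (π⁺ρ⁺ (fromℕ (suc m)))))
      (closing π⁺ ρ⁺ (insert-⊑ E r c π (row c) π⊑) half⁺)

-- Row ρ(last) and column π(ρ(0)) are full.  Exchanging the two ends of the order in π yields
-- a perfect matching containing their common edge, so both can be deleted.
orderable-closing⇒complete : ∀ {n} (E : Mat (suc n)) π → π ⊑ E → Orderable E → Closing E →
  ∀ i j → E i j ≡ true
orderable-closing⇒complete {zero} E π π⊑ _ _ zero zero = trans (cong (E zero) (only zero _)) (π⊑ zero)
  where
  only : (x y : Fin 1) → x ≡ y
  only zero zero = refl
orderable-closing⇒complete {suc n} E π π⊑ ord closing i j =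
  decidable-stable (E i j BP.≟ true) λ ≢true → ord π π⊑ λ (ρ , half) → ≢true (full ρ half i j)
  where
  full : ∀ ρ → Half E π ρ → ∀ i j → E i j ≡ true
  full ρ half = λ i j → fill i j (at? r i) (at? c j)
    where
    l = ρ ⟨$⟩ʳ zero
    r = ρ ⟨$⟩ʳ fromℕ (suc n)
    c = π ⟨$⟩ʳ l
    row : ∀ j → E r j ≡ true
    row j = trans (cong (E r) (sym (trans (cong (π ⟨$⟩ʳ_) (inverseʳ ρ)) (inverseʳ π))))
      (half _ (ρ ⟨$⟩ˡ (π ⟨$⟩ˡ j)) (FP.≤fromℕ _))
    col : ∀ i → E i c ≡ true
    col i = trans (cong (λ z → E z c) (sym (inverseʳ ρ))) (half (ρ ⟨$⟩ˡ i) zero z≤n)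
    -- Row `r` receives `c`, the partner of `l`, and `l` receives the old partner of `r`; the latter
    -- edge exists by `closing`.
    π′ = transpose r l ∘ₚ π
    π′r : π′ ⟨$⟩ʳ r ≡ c
    π′r with r FP.≟ r
    ... | yes _  = refl
    ... | no r≢r = contradiction refl r≢r
    π′⊑ : π′ ⊑ E
    π′⊑ i with i FP.≟ r
    ... | yes refl = col r
    ... | no _ with i FP.≟ l
    ...   | yes refl = closing π ρ π⊑ half
    ...   | no _     = π⊑ i
    inner : ∀ i j → minor r c E i j ≡ true
    inner = orderable-closing⇒complete (minor r c E) (remove r π′) (remove-⊑ E π′ π′⊑ π′r)
      (minor-orderable E r c (row c) ord) (minor-closing E r c row col closing)
    fill : ∀ i j → At r i → At c j → E i j ≡ true
    fill _ j at      _       = row j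
    fill i _ (off _) at      = col i
    fill _ _ (off k) (off m) = inner k m

-- A Hamiltonian cycle of the half graph minus its two extremal vertices

relabel : ∀ {n} → Mat n → Permutation′ n → Permutation′ n → Mat n
relabel E ρ κ i j = E (ρ ⟨$⟩ʳ i) (κ ⟨$⟩ʳ j)

cnt-relabel : ∀ {n} (T : Mat n) ρ κ → cnt (relabel T ρ κ) ≡ cnt T
cnt-relabel T ρ κ = trans (sum-cong-≗ λ i → sym (sum-permute (λ j → bit (T (ρ ⟨$⟩ʳ i) j)) κ))
  (sym (sum-permute (weight ∘ T) ρ))

-- Rows and columns are renamed independently, so a matching `σ` turns into `ρ` followed by `σ` and
-- the inverse of `κ`.
relabel-coforcing : ∀ {n} (E T : Mat n) ρ κ → CoForcing (relabel E ρ κ) T →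
  CoForcing E (relabel T (flip ρ) (flip κ))
relabel-coforcing {n} E T ρ κ cf σ τ σ⊑ τ⊑ a b i = begin
  σ ⟨$⟩ʳ i                       ≡⟨ cong (σ ⟨$⟩ʳ_) (inverseʳ ρ) ⟨
  σ ⟨$⟩ʳ (ρ ⟨$⟩ʳ i′)              ≡⟨ inverseʳ κ ⟨
  κ ⟨$⟩ʳ (conj σ ⟨$⟩ʳ i′)         ≡⟨ cong (κ ⟨$⟩ʳ_) (cf (conj σ) (conj τ) (conj-⊑ σ σ⊑) (conj-⊑ τ τ⊑) (agree σ τ a) (agree τ σ b) i′) ⟩
  κ ⟨$⟩ʳ (conj τ ⟨$⟩ʳ i′)         ≡⟨ inverseʳ κ ⟩
  τ ⟨$⟩ʳ (ρ ⟨$⟩ʳ i′)              ≡⟨ cong (τ ⟨$⟩ʳ_) (inverseʳ ρ) ⟩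
  τ ⟨$⟩ʳ i                       ∎
  where
  open ≡-Reasoning
  i′ = ρ ⟨$⟩ˡ i
  conj : Permutation′ n → Permutation′ n
  conj σ = ρ ∘ₚ (σ ∘ₚ flip κ)
  conj-⊑ : ∀ σ → σ ⊑ E → conj σ ⊑ relabel E ρ κ
  conj-⊑ σ σ⊑ i = trans (cong (E (ρ ⟨$⟩ʳ i)) (inverseʳ κ)) (σ⊑ (ρ ⟨$⟩ʳ i))
  agree : ∀ σ τ → AgreeOff (relabel T (flip ρ) (flip κ)) σ τ → AgreeOff T (conj σ) (conj τ)
  agree σ τ a i out = cong (κ ⟨$⟩ˡ_) (a (ρ ⟨$⟩ʳ i)
    (trans (cong (λ z → T z (conj σ ⟨$⟩ʳ i)) (inverseˡ ρ)) out))

weight-extra : ∀ {n} (f : Fin (suc n) → Bool) c → f c ≡ true → 1 + weight (f ∘ punchIn c) ≤ weight f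
weight-extra f c fc = ≤-reflexive (trans (cong (_+ weight (f ∘ punchIn c)) (cong bit (sym fc)))
  (sym (sum-remove {i = c} (bit ∘ f))))

weight-two : ∀ {n} (f : Fin n → Bool) c d → c ≢ d → f c ≡ true → f d ≡ true → 2 ≤ weight f
weight-two {suc n} f c d c≢d fc fd with at? c d
... | at    = contradiction refl c≢d
... | off k = ≤-trans (s≤s (weight-pos (f ∘ punchIn c) k fd)) (weight-extra f c fc)

sum-const : ∀ n c → sum {n} (λ _ → c) ≡ n * c
sum-const zero    c = refl
sum-const (suc n) c = cong (c +_) (sum-const n c)

module Cycle (k : ℕ) where

  private
    n : ℕ
    n = suc (suc (suc k))

  last : Fin n
  last = fromℕ (suc (suc k))

  -- Row 0 and column `last` have only their diagonal entries and are pendant; the other diagonal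
  -- entries, the subdiagonal and the corner `(last , 0)` form a cycle through all other rows and
  -- columns. Order at least three keeps the corner off the subdiagonal.
  Edge : Fin n → Fin n → Set
  Edge i j = i ≡ j ⊎ toℕ i ≡ suc (toℕ j) ⊎ (i ≡ last × j ≡ zero)

  edge? : ∀ i j → Dec (Edge i j)
  edge? i j = i FP.≟ j ⊎-dec toℕ i ≟ suc (toℕ j) ⊎-dec (i FP.≟ last ×-dec j FP.≟ zero)

  T : Mat n
  T i j = does (edge? i j)

  edge : ∀ {i j} → T i j ≡ true → Edge i j
  edge {i} {j} = does-true (edge? i j)

  T-edge : ∀ {i j} → Edge i j → T i j ≡ true
  T-edge {i} {j} e = dec-true (edge? i j) e

  -- Row 0 has one entry and every later row a diagonal and a subdiagonal one; `isLast` adds the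
  -- corner.
  cnt-T : 2 * n ≤ cnt T
  cnt-T = begin
    2 * n                                                        ≡⟨ arith k ⟩
    1 + (suc (suc k) * 2 + 1)                                    ≤⟨ +-mono-≤ (weight-pos (T zero) zero (T-edge {zero} (inj₁ refl))) (begin
      suc (suc k) * 2 + 1                                          ≡⟨ cong (_+ 1) (sum-const (suc (suc k)) 2) ⟨
      sum {suc (suc k)} (λ _ → 2) + 1                              ≤⟨ +-monoʳ-≤ (sum {suc (suc k)} (λ _ → 2)) (weight-pos isLast (fromℕ (suc k)) (dec-true (fromℕ (suc k) FP.≟ _) refl)) ⟩
      sum {suc (suc k)} (λ _ → 2) + weight isLast                  ≡⟨ ∑-distrib-+ {suc (suc k)} (λ _ → 2) (bit ∘ isLast) ⟨
      sum {suc (suc k)} (λ i → 2 + bit (isLast i))                 ≤⟨ sum-mono (λ i → rows i (i FP.≟ fromℕ (suc k))) ⟩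
      sum {suc (suc k)} (λ i → weight (T (suc i)))                 ∎) ⟩
    cnt T                                                        ∎
    where
    open ≤-Reasoning
    arith : ∀ k → 2 * suc (suc (suc k)) ≡ 1 + (suc (suc k) * 2 + 1)
    arith = solve-∀
    isLast : Fin (suc (suc k)) → Bool
    isLast i = does (i FP.≟ fromℕ (suc k))
    suc≢inject₁ : ∀ {m} (i : Fin m) → suc i ≢ Fin.inject₁ i
    suc≢inject₁ (suc i) eq = suc≢inject₁ i (FP.suc-injective eq)
    rows : ∀ i (d : Dec (i ≡ fromℕ (suc k))) → 2 + bit (does d) ≤ weight (T (suc i))
    rows i (no _)     = weight-two (T (suc i)) (suc i) (Fin.inject₁ i) (suc≢inject₁ i)
      (T-edge {suc i} (inj₁ refl)) (T-edge {suc i} (inj₂ (inj₁ (cong suc (sym (FP.toℕ-inject₁ i))))))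
    rows _ (yes refl) = ≤-trans (s≤s (weight-two (T last ∘ suc) (fromℕ (suc k)) (Fin.inject₁ (fromℕ k)) (suc≢inject₁ (fromℕ k))
      (T-edge {last} (inj₁ refl)) (T-edge {last} (inj₂ (inj₁ (cong suc (sym (FP.toℕ-inject₁ (fromℕ (suc k)))))))))) (weight-extra (T last) zero (T-edge {last} (inj₂ (inj₂ (refl , refl)))))

  module _ (E : Mat n) (open-ends : E zero last ≡ false) where

    private
      toℕ-last : toℕ last ≡ suc (suc k)
      toℕ-last = FP.toℕ-fromℕ (suc (suc k))

      interior : ∀ {b} (i : Fin (suc k)) → toℕ b ≡ suc (toℕ i) → b ≢ last
      interior i b≡ refl = <⇒≢ (FP.toℕ<n i) (suc-injective (trans (sym b≡) toℕ-last))

    -- The contrapositive of `AgreeOff`: differences are confined to the few positions of `Edge`,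
    -- which makes the case analyses below possible.
    differ-edge : ∀ σ τ → AgreeOff T σ τ → ∀ {i j} → σ ⟨$⟩ʳ i ≡ j → τ ⟨$⟩ʳ i ≢ j → Edge i j
    differ-edge σ τ a {i} refl τ≢ with T i (σ ⟨$⟩ʳ i) in eq
    ... | true  = edge eq
    ... | false = contradiction (a i eq) τ≢

    -- A difference at a subdiagonal entry spreads along the whole cycle, which leaves
    -- only the missing edge for row 0.
    no-shift : ∀ σ τ → τ ⊑ E → AgreeOff T σ τ → AgreeOff T τ σ → ∀ a →
      toℕ a ≡ suc (toℕ (τ ⟨$⟩ʳ a)) → τ ⟨$⟩ʳ a ≢ σ ⟨$⟩ʳ a → ⊥
    no-shift σ τ τ⊑ στ τσ zero ()
    no-shift σ τ τ⊑ στ τσ (suc i₀) τi σi = only-row-zero (τ ⟨$⟩ˡ last) (inverseʳ τ)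
      where
      Shifted : Fin n → Set
      Shifted a = toℕ a ≡ suc (toℕ (τ ⟨$⟩ʳ a)) × τ ⟨$⟩ʳ a ≢ σ ⟨$⟩ʳ a
      -- Row `a` is not the last, so `σ` must use its diagonal entry. Then `τ` covers column `a` in
      -- another row, and the only other entry of `T` there is the next subdiagonal one.
      up : ∀ i → Shifted (suc (Fin.inject₁ i)) → Shifted (suc (suc i))
      up i (τa , τa≢σa) = go (differ-edge σ τ στ refl τa≢σa)
        where
        a = suc (Fin.inject₁ i)
        s = τ ⟨$⟩ˡ a
        toℕ-a : toℕ a ≡ suc (toℕ i)
        toℕ-a = cong suc (FP.toℕ-inject₁ i)
        next : σ ⟨$⟩ʳ a ≡ a → Edge s a → Shifted (suc (suc i))
        next σa (inj₁ s≡a) = contradiction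
          (trans τa (cong (suc ∘ toℕ) (trans (cong (τ ⟨$⟩ʳ_) (sym s≡a)) (inverseʳ τ)))) (m≢1+m+n _ ∘ λ eq → trans eq (cong suc (sym (+-identityʳ _))))
        next σa (inj₂ (inj₁ s≡)) = subst Shifted s≡2+i
          (trans s≡ (cong (suc ∘ toℕ) (sym (inverseʳ τ))) , λ eq → <⇒≢ (n<1+n _)
            (trans (cong toℕ (Permutation-injective σ (trans σa (trans (sym (inverseʳ τ)) eq)))) s≡))
          where
          s≡2+i : s ≡ suc (suc i)
          s≡2+i = FP.toℕ-injective (trans s≡ (cong suc toℕ-a))
        go : Edge a (σ ⟨$⟩ʳ a) → Shifted (suc (suc i))
        go (inj₂ (inj₁ σa)) = contradiction (FP.toℕ-injective (suc-injective (trans (sym τa) σa))) τa≢σa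
        go (inj₂ (inj₂ (a≡ , _))) = contradiction a≡ (interior i toℕ-a)
        go (inj₁ σa) = next (sym σa) (differ-edge τ σ τσ (inverseʳ τ) λ eq →
          τa≢σa (trans (cong (τ ⟨$⟩ʳ_) (Permutation-injective σ (trans (sym σa) (sym eq)))) (trans (inverseʳ τ) σa)))
      -- Backwards, column `b` comes first: there `σ` can only use the diagonal entry, which leaves
      -- `τ` the subdiagonal one in row `b`.
      down : ∀ i → Shifted (suc (suc i)) → Shifted (suc (Fin.inject₁ i))
      down i (τa , τa≢σa) = subst Shifted b≡1+i (column (differ-edge σ τ στ (inverseʳ σ) λ eq →
          τa≢σa (trans (sym (inverseʳ σ)) (cong (σ ⟨$⟩ʳ_) (Permutation-injective τ eq)))))
        where
        a b r : Fin n
        a = suc (suc i)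
        b = τ ⟨$⟩ʳ a
        r = σ ⟨$⟩ˡ b
        toℕ-b : toℕ b ≡ suc (toℕ i)
        toℕ-b = suc-injective (sym τa)
        b≡1+i : b ≡ suc (Fin.inject₁ i)
        b≡1+i = FP.toℕ-injective (trans toℕ-b (cong suc (sym (FP.toℕ-inject₁ i))))
        b≢τb : τ ⟨$⟩ʳ b ≢ b
        b≢τb eq = <⇒≢ (n<1+n _) (trans (cong toℕ (Permutation-injective τ eq)) τa)
        row : σ ⟨$⟩ʳ b ≡ b → Edge b (τ ⟨$⟩ʳ b) → Shifted b
        row σb (inj₁ eq)               = contradiction (sym eq) b≢τb
        row σb (inj₂ (inj₁ τb))        = τb , λ eq → b≢τb (trans eq σb)
        row σb (inj₂ (inj₂ (b≡ , _)))  = contradiction b≡ (interior i toℕ-b)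
        column : Edge r b → Shifted b
        column (inj₁ r≡b) = row σb (differ-edge τ σ τσ refl λ eq → b≢τb (trans (sym eq) σb))
          where
          σb : σ ⟨$⟩ʳ b ≡ b
          σb = trans (cong (σ ⟨$⟩ʳ_) (sym r≡b)) (inverseʳ σ)
        column (inj₂ (inj₁ r≡)) = contradiction
          (trans (sym (inverseʳ σ)) (cong (σ ⟨$⟩ʳ_) (FP.toℕ-injective (trans r≡ (sym τa))))) τa≢σa
        column (inj₂ (inj₂ (_ , b≡0))) = contradiction (trans (sym (cong toℕ b≡0)) toℕ-b) λ ()
      all-shifted : ∀ i → Shifted (suc i)
      -- Descend from the given row to row 1, then climb to every row.
      all-shifted = <-weakInduction (Shifted ∘ suc)
        (<-weakInduction (λ i → Shifted (suc i) → Shifted (suc zero)) (λ p → p)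
          (λ i rec → rec ∘ down i) i₀ (τi , σi)) up
      -- All other rows use columns before `last`, so column `last` falls to row 0, where `E` has no
      -- entry.
      only-row-zero : ∀ s → τ ⟨$⟩ʳ s ≡ last → ⊥
      only-row-zero zero    eq = true≢false (trans (sym (trans (cong (E zero) (sym eq)) (τ⊑ zero))) open-ends)
      only-row-zero (suc i) eq = <⇒≢ (FP.toℕ<n i)
        (suc-injective (trans (proj₁ (all-shifted i)) (cong suc (trans (cong toℕ eq) toℕ-last))))

    -- Column `last` meets `T` only on the diagonal, so `τ`, having left that entry, cannot cover
    -- the column by an edge of `T`.
    no-corner : ∀ σ τ → AgreeOff T τ σ → last ≡ σ ⟨$⟩ʳ last → τ ⟨$⟩ʳ last ≡ zero → ⊥
    no-corner σ τ τσ σl τl = go (differ-edge τ σ τσ (inverseʳ τ) λ eq → s≢l (Permutation-injective σ (trans eq σl)))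
      where
      s = τ ⟨$⟩ˡ last
      s≢l : s ≢ last
      s≢l eq with () ← trans (sym (inverseʳ τ)) (trans (cong (τ ⟨$⟩ʳ_) eq) τl)
      go : Edge s last → ⊥
      go (inj₁ s≡l)       = s≢l s≡l
      go (inj₂ (inj₁ s≡)) = <⇒≢ (FP.toℕ<n s) (trans s≡ (cong suc toℕ-last))

    -- In a row where they differ the matchings use two distinct entries of `T`: either one is
    -- subdiagonal, or they are the diagonal entry and the corner of the last row.
    T-coforcing : CoForcing E T
    T-coforcing σ τ σ⊑ τ⊑ στ τσ i with σ ⟨$⟩ʳ i FP.≟ τ ⟨$⟩ʳ i
    ... | yes eq = eq
    ... | no ne  = ⊥-elim (go i ne (differ-edge σ τ στ refl (ne ∘ sym)) (differ-edge τ σ τσ refl ne))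
      where
      go : ∀ i → σ ⟨$⟩ʳ i ≢ τ ⟨$⟩ʳ i → Edge i (σ ⟨$⟩ʳ i) → Edge i (τ ⟨$⟩ʳ i) → ⊥
      go i ne (inj₂ (inj₁ σi)) _ = no-shift τ σ σ⊑ τσ στ i σi ne
      go i ne _ (inj₂ (inj₁ τi)) = no-shift σ τ τ⊑ στ τσ i τi (ne ∘ sym)
      go i ne (inj₁ p) (inj₁ q)  = ne (trans (sym p) q)
      go _ ne (inj₁ p) (inj₂ (inj₂ (refl , q))) = no-corner σ τ τσ p q
      go _ ne (inj₂ (inj₂ (refl , p))) (inj₁ q) = no-corner τ σ στ q p
      go _ ne (inj₂ (inj₂ (_ , p))) (inj₂ (inj₂ (_ , q))) = ne (trans p (sym q))

-- The edges of `Cycle.T` lie on or below the diagonal, hence inside the half graph once its order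
-- is used as labelling.
large-coforcing : ∀ {k} (E : Mat (suc (suc (suc k)))) π ρ → Half E π ρ →
  E (ρ ⟨$⟩ʳ zero) (π ⟨$⟩ʳ (ρ ⟨$⟩ʳ Cycle.last k)) ≡ false →
  ∃ λ T → T ⊆M E × CoForcing E T × 2 * suc (suc (suc k)) ≤ cnt T
large-coforcing {k} E π ρ half open-ends = T , T⊆E ,
  relabel-coforcing E (Cycle.T k) ρ κ (Cycle.T-coforcing k (relabel E ρ κ) open-ends) ,
  ≤-trans (Cycle.cnt-T k) (≤-reflexive (sym (cnt-relabel (Cycle.T k) (flip ρ) (flip κ))))
  where
  κ = ρ ∘ₚ π
  T = relabel (Cycle.T k) (flip ρ) (flip κ)
  below : ∀ {i j} → Cycle.Edge k i j → j Fin.≤ i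
  below (inj₁ refl)                = ≤-refl
  below (inj₂ (inj₁ eq))           = ≤-trans (n≤1+n _) (≤-reflexive (sym eq))
  below (inj₂ (inj₂ (_ , refl)))   = z≤n
  T⊆E : T ⊆M E
  T⊆E i j t = trans (cong₂ E (sym (inverseʳ ρ)) (sym (inverseʳ κ))) (half _ _ (below (Cycle.edge k t)))

-- Colour classes of a bipartite graph

-- `sum-split` is a field because it arises along the same recursion as the enumerations, which
-- saves a separate reindexing argument.
record Classes {m} (c : Fin m → Bool) (p q : ℕ) : Set where
  field
    A         : Fin p → Fin m
    B         : Fin q → Fin m
    locate    : Fin m → Fin p ⊎ Fin q
    A-true    : ∀ i → c (A i) ≡ true
    B-false   : ∀ j → c (B j) ≡ false
    locate-A  : ∀ i → locate (A i) ≡ inj₁ i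
    locate-B  : ∀ j → locate (B j) ≡ inj₂ j
    located   : ∀ v → Sum.[ A , B ]′ (locate v) ≡ v
    sum-split : ∀ (f : Fin m → ℕ) → sum f ≡ sum (f ∘ A) + sum (f ∘ B)

  A-injective : ∀ {i j} → A i ≡ A j → i ≡ j
  A-injective eq = inj₁-injective (trans (sym (locate-A _)) (trans (cong locate eq) (locate-A _)))

  B-injective : ∀ {i j} → B i ≡ B j → i ≡ j
  B-injective eq = inj₂-injective (trans (sym (locate-B _)) (trans (cong locate eq) (locate-B _)))

  B≢A : ∀ {i j} → B j ≢ A i
  B≢A eq with () ← trans (sym (locate-B _)) (trans (cong locate eq) (locate-A _))

  data Vertex : Fin m → Set where
    inA : ∀ i → Vertex (A i)
    inB : ∀ j → Vertex (B j)

  vertex : ∀ v → Vertex v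
  vertex v with locate v | located v
  ... | inj₁ i | refl = inA i
  ... | inj₂ j | refl = inB j

  data Opposite : Fin m → Fin m → Set where
    AB : ∀ i j → Opposite (A i) (B j)
    BA : ∀ j i → Opposite (B j) (A i)

  opposite : ∀ u v → c u ≢ c v → Opposite u v
  opposite u v c≢ with vertex u | vertex v
  ... | inA i | inA j = contradiction (trans (A-true i) (sym (A-true j))) c≢
  ... | inA i | inB j = AB i j
  ... | inB i | inA j = BA i j
  ... | inB i | inB j = contradiction (trans (B-false i) (sym (B-false j))) c≢

classes : ∀ {m} (c : Fin m → Bool) → ∃₂ (Classes c)
classes {zero} c = 0 , 0 , record
  { A = λ () ; B = λ () ; locate = λ () ; A-true = λ () ; B-false = λ () ; locate-A = λ ()
  ; locate-B = λ () ; located = λ () ; sum-split = λ _ → refl }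
classes {suc m} c with classes (c ∘ suc) | c zero in c₀
... | p , q , cl | true = suc p , q , record
  { A         = zero ∷ (suc ∘ A)
  ; B         = suc ∘ B
  ; locate    = λ { zero → inj₁ zero ; (suc v) → Sum.map₁ suc (locate v) }
  ; A-true    = λ { zero → c₀ ; (suc i) → A-true i }
  ; B-false   = B-false
  ; locate-A  = λ { zero → refl ; (suc i) → cong (Sum.map₁ suc) (locate-A i) }
  ; locate-B  = λ j → cong (Sum.map₁ suc) (locate-B j)
  ; located   = λ { zero → refl ; (suc v) → located-suc v }
  ; sum-split = λ f → trans (cong (f zero +_) (sum-split (f ∘ suc))) (sym (+-assoc (f zero) _ _))
  }
  where
  open Classes cl
  located-suc : ∀ v → Sum.[ (zero ∷ (suc ∘ A)) , suc ∘ B ]′ (Sum.map₁ suc (locate v)) ≡ suc v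
  located-suc v with locate v | located v
  ... | inj₁ i | refl = refl
  ... | inj₂ j | refl = refl
... | p , q , cl | false = p , suc q , record
  { A         = suc ∘ A
  ; B         = zero ∷ (suc ∘ B)
  ; locate    = λ { zero → inj₂ zero ; (suc v) → Sum.map₂ suc (locate v) }
  ; A-true    = A-true
  ; B-false   = λ { zero → c₀ ; (suc j) → B-false j }
  ; locate-A  = λ i → cong (Sum.map₂ suc) (locate-A i)
  ; locate-B  = λ { zero → refl ; (suc j) → cong (Sum.map₂ suc) (locate-B j) }
  ; located   = λ { zero → refl ; (suc v) → located-suc v }
  ; sum-split = λ f → trans (cong (f zero +_) (sum-split (f ∘ suc))) (x∙yz≈y∙xz (f zero) (sum (f ∘ suc ∘ A)) _)
  }
  where
  open Classes cl
  located-suc : ∀ v → Sum.[ suc ∘ A , (zero ∷ (suc ∘ B)) ]′ (Sum.map₂ suc (locate v)) ≡ suc v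
  located-suc v with locate v | located v
  ... | inj₁ i | refl = refl
  ... | inj₂ j | refl = refl

Coloured : ∀ {m} → (Fin m → Bool) → EdgeSet m → Set
Coloured c S = ∀ u v → S u v ≡ true → c u ≢ c v

module Mates {m} {c : Fin m → Bool} {p q} (cl : Classes c p q) (G : Graph m)
  (bip : Coloured c (adj G)) (M : EdgeSet m) (pm : IsPM G M) where

  open Classes cl

  mate : Fin m → Fin m
  mate v = proj₁ (proj₂ pm v)

  M-mate : ∀ v → M v (mate v) ≡ true
  M-mate v = proj₁ (proj₂ (proj₂ pm v))

  mate-unique : ∀ {u v} → M u v ≡ true → v ≡ mate u
  mate-unique {u} {v} = proj₂ (proj₂ (proj₂ pm u)) v

  mate-involutive : ∀ v → mate (mate v) ≡ v
  mate-involutive v = sym (mate-unique (trans (proj₁ (proj₁ pm) (mate v) v) (M-mate v)))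

  opposite-mate : ∀ v → Opposite v (mate v)
  opposite-mate v = opposite v (mate v) (bip v _ (proj₂ (proj₁ pm) _ _ (M-mate v)))

  A-mate : ∀ i → ∃ λ j → B j ≡ mate (A i)
  A-mate i with A i in eq | mate (A i) | opposite-mate (A i)
  ... | _ | _ | AB _ j = j , refl
  ... | _ | _ | BA _ _ = contradiction (sym eq) B≢A

  B-mate : ∀ j → ∃ λ i → A i ≡ mate (B j)
  B-mate j with B j in eq | mate (B j) | opposite-mate (B j)
  ... | _ | _ | AB _ _ = contradiction eq B≢A
  ... | _ | _ | BA _ i = i , refl

  to : Fin p → Fin q
  to = proj₁ ∘ A-mate

  from : Fin q → Fin p
  from = proj₁ ∘ B-mate

  to∘from : ∀ j → to (from j) ≡ j
  to∘from j = B-injective (trans (proj₂ (A-mate (from j)))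
    (trans (cong mate (proj₂ (B-mate j))) (mate-involutive (B j))))

  from∘to : ∀ i → from (to i) ≡ i
  from∘to i = A-injective (trans (proj₂ (B-mate (to i)))
    (trans (cong mate (proj₂ (A-mate i))) (mate-involutive (A i))))

  balanced : p ≡ q
  balanced = ≤-antisym
    (FP.injective⇒≤ {f = to} λ eq → trans (sym (from∘to _)) (trans (cong from eq) (from∘to _)))
    (FP.injective⇒≤ {f = from} λ eq → trans (sym (to∘from _)) (trans (cong to eq) (to∘from _)))

class-size : ∀ {n p} {c : Fin (n + n) → Bool} → Classes c p p → n ≡ p
class-size {n} {p} cl = *-cancelˡ-≡ n p 2 (trans (cong (n +_) (+-identityʳ n))
  (trans total (sym (cong (p +_) (+-identityʳ p)))))
  where
  open ≡-Reasoning
  total : n + n ≡ p + p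
  total = begin
    n + n                                        ≡⟨ *-identityʳ (n + n) ⟨
    (n + n) * 1                                  ≡⟨ sum-const (n + n) 1 ⟨
    sum {n + n} (λ _ → 1)                        ≡⟨ Classes.sum-split cl (λ _ → 1) ⟩
    sum {p} (λ _ → 1) + sum {p} (λ _ → 1)        ≡⟨ cong (λ x → x + x) (trans (sum-const p 1) (*-identityʳ p)) ⟩
    p + p                                        ∎

balanced-classes : ∀ {n} {c : Fin (n + n) → Bool} (G : Graph (n + n)) → Coloured c (adj G) → HasPM G →
  Classes c n n
balanced-classes {n} {c} G bip (M , pm) with p , q , cl ← classes c
  with refl ← Mates.balanced cl G bip M pm
  = subst (λ k → Classes c k k) (sym (class-size {n} cl)) cl

-- Edge sets as matrices

list-sum : ∀ {m} (f : Fin m → ℕ) → List.sum (List.map f (List.allFin m)) ≡ sum f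
list-sum f = trans (cong List.sum (map-tabulate (λ i → i) f)) (sum-tabulate f)
  where
  sum-tabulate : ∀ {m} (f : Fin m → ℕ) → List.sum (List.tabulate f) ≡ sum f
  sum-tabulate {zero}  f = refl
  sum-tabulate {suc m} f = cong (f zero +_) (sum-tabulate (f ∘ suc))

size-sum : ∀ {m} (S : EdgeSet m) → size S ≡ sum (λ u → weight (λ v → (toℕ u <ᵇ toℕ v) ∧ S u v))
size-sum {m} S = trans (list-sum {m} _) (sum-cong-≗ {m} λ u →
  trans (cong List.sum (sym (map-∘ (List.allFin m)))) (list-sum {m} _))

<ᵇ-flip : ∀ a b → a ≢ b → (b <ᵇ a) ≡ not (a <ᵇ b)
<ᵇ-flip zero    zero    a≢b = contradiction refl a≢b
<ᵇ-flip zero    (suc b) _   = refl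
<ᵇ-flip (suc a) zero    _   = refl
<ᵇ-flip (suc a) (suc b) a≢b = <ᵇ-flip a b (a≢b ∘ cong suc)

module Matrices {n} {c : Fin (n + n) → Bool} (cl : Classes c n n) where

  open Classes cl

  toMat : EdgeSet (n + n) → Mat n
  toMat S i j = S (A i) (B j)

  fromMat : Mat n → EdgeSet (n + n)
  fromMat T u v = entry (locate u) (locate v)
    where
    entry : Fin n ⊎ Fin n → Fin n ⊎ Fin n → Bool
    entry (inj₁ i) (inj₂ j) = T i j
    entry (inj₂ j) (inj₁ i) = T i j
    entry _        _        = false

  fromMat-AB : ∀ T i j → fromMat T (A i) (B j) ≡ T i j
  fromMat-AB T i j rewrite locate-A i | locate-B j = refl

  fromMat-BA : ∀ T i j → fromMat T (B j) (A i) ≡ T i j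
  fromMat-BA T i j rewrite locate-A i | locate-B j = refl

  fromMat-sym : ∀ T → IsSym (fromMat T)
  fromMat-sym T u v with locate u | locate v
  ... | inj₁ _ | inj₁ _ = refl
  ... | inj₁ _ | inj₂ _ = refl
  ... | inj₂ _ | inj₁ _ = refl
  ... | inj₂ _ | inj₂ _ = refl

  fromMat-coloured : ∀ T → Coloured c (fromMat T)
  fromMat-coloured T u v t with locate u | located u | locate v | located v
  ... | inj₁ i | refl | inj₂ j | refl = λ eq → true≢false (trans (sym (A-true i)) (trans eq (B-false j)))
  ... | inj₂ j | refl | inj₁ i | refl = λ eq → true≢false (trans (sym (A-true i)) (trans (sym eq) (B-false j)))

  ⊆-from-matrix : ∀ {S S′ : EdgeSet (n + n)} → IsSym S → IsSym S′ → Coloured c S →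
    toMat S ⊆M toMat S′ → ∀ u v → S u v ≡ true → S′ u v ≡ true
  ⊆-from-matrix {S} {S′} symS symS′ col sub u v t with opposite u v (col u v t)
  ... | AB i j = sub i j t
  ... | BA j i = trans (symS′ (B j) (A i)) (sub i j (trans (symS (A i) (B j)) t))

  -- `size` counts an edge at its smaller vertex, which may lie in either class; after splitting by
  -- colour, exactly one of the two orientations contributes.
  size-cnt : ∀ S → IsSym S → Coloured c S → size S ≡ cnt (toMat S)
  size-cnt S symS col = begin
    size S                                                    ≡⟨ size-sum S ⟩
    sum (λ u → sum (U u))                                     ≡⟨ sum-split (λ u → sum (U u)) ⟩
    sum (λ i → sum (U (A i))) + sum (λ j → sum (U (B j)))     ≡⟨ cong₂ _+_ (sum-cong-≗ {n} rowA) (sum-cong-≗ {n} rowB) ⟩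
    sum (λ i → sum (λ j → U (A i) (B j))) + sum (λ j → sum (λ i → U (B j) (A i)))
      ≡⟨ cong (sum (λ i → sum (λ j → U (A i) (B j))) +_) (∑-comm (λ j i → U (B j) (A i))) ⟩
    sum (λ i → sum (λ j → U (A i) (B j))) + sum (λ i → sum (λ j → U (B j) (A i)))
      ≡⟨ ∑-distrib-+ (λ i → sum (λ j → U (A i) (B j))) (λ i → sum (λ j → U (B j) (A i))) ⟨
    sum (λ i → sum (λ j → U (A i) (B j)) + sum (λ j → U (B j) (A i)))
      ≡⟨ sum-cong-≗ {n} (λ i → trans (sym (∑-distrib-+ (λ j → U (A i) (B j)) (λ j → U (B j) (A i)))) (sum-cong-≗ {n} (once i))) ⟩
    cnt (toMat S)                                             ∎
    where
    open ≡-Reasoning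
    U : Fin (n + n) → Fin (n + n) → ℕ
    U u v = bit ((toℕ u <ᵇ toℕ v) ∧ S u v)
    same-colour : ∀ u v → c u ≡ c v → U u v ≡ 0
    same-colour u v eq with S u v in s
    ... | true  = contradiction eq (col u v s)
    ... | false = cong bit (BP.∧-zeroʳ (toℕ u <ᵇ toℕ v))
    sum-zero : ∀ {k} {f : Fin k → ℕ} → (∀ i → f i ≡ 0) → sum f ≡ 0
    sum-zero {k} f≡0 = trans (sum-cong-≗ f≡0) (trans (sum-const k 0) (*-zeroʳ k))
    rowA : ∀ i → sum (U (A i)) ≡ sum (λ j → U (A i) (B j))
    rowA i = trans (sum-split (U (A i))) (cong (_+ sum (λ j → U (A i) (B j)))
      (sum-zero λ k → same-colour (A i) (A k) (trans (A-true i) (sym (A-true k)))))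
    rowB : ∀ j → sum (U (B j)) ≡ sum (λ i → U (B j) (A i))
    rowB j = trans (sum-split (U (B j))) (trans (cong (sum (λ i → U (B j) (A i)) +_)
      (sum-zero λ k → same-colour (B j) (B k) (trans (B-false j) (sym (B-false k))))) (+-identityʳ _))
    once : ∀ i j → U (A i) (B j) + U (B j) (A i) ≡ bit (toMat S i j)
    once i j rewrite symS (B j) (A i) | <ᵇ-flip (toℕ (A i)) (toℕ (B j)) (λ eq → B≢A (sym (FP.toℕ-injective eq)))
      with toℕ (A i) <ᵇ toℕ (B j) | S (A i) (B j)
    ... | true  | true  = refl
    ... | true  | false = refl
    ... | false | true  = refl
    ... | false | false = refl

-- Forcing and anti-forcing sets in matrix form

-- Descent on the size. `P` need not be decidable, so a minimum is only shown not to be absent.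
minimum : ∀ {m} (P : EdgeSet m → Set) S → P S → ¬ ¬ ∃ (IsMinSize P)
minimum P S PS none = go S PS (<-wellFounded (size S))
  where
  go : ∀ S → P S → Acc _<_ (size S) → ⊥
  go S PS (acc rec) = none (size S , (S , PS , refl) , λ S′ PS′ → ≮⇒≥ λ lt → go S′ PS′ (rec lt))

module Matchings {n} {c : Fin (n + n) → Bool} (cl : Classes c n n) where

  open Classes cl
  open Matrices cl

  permMat : Permutation′ n → Mat n
  permMat π i j = does (π ⟨$⟩ʳ i FP.≟ j)

  permMat-diag : ∀ π i → permMat π i (π ⟨$⟩ʳ i) ≡ true
  permMat-diag π i = dec-true (π ⟨$⟩ʳ i FP.≟ _) refl

  permMat-entry : ∀ π {i j} → permMat π i j ≡ true → π ⟨$⟩ʳ i ≡ j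
  permMat-entry π {i} {j} = does-true (π ⟨$⟩ʳ i FP.≟ j)

  fromPerm : Permutation′ n → EdgeSet (n + n)
  fromPerm π = fromMat (permMat π)

  HasMatrix : EdgeSet (n + n) → Permutation′ n → Set
  HasMatrix M π = ∀ i j → M (A i) (B j) ≡ permMat π i j

  fromPerm-matrix : ∀ π → HasMatrix (fromPerm π) π
  fromPerm-matrix π = fromMat-AB (permMat π)

  HasMatrix-entry : ∀ {M π i} → HasMatrix M π → M (A i) (B (π ⟨$⟩ʳ i)) ≡ true
  HasMatrix-entry {π = π} {i} mat = trans (mat i _) (permMat-diag π i)

  module _ (G : Graph (n + n)) (bip : Coloured c (adj G)) where

    private
      E = toMat (adj G)

    matching-perm : ∀ {M} → IsPM G M → ∃ (HasMatrix M)
    matching-perm {M} pm = permutation to from to∘from from∘to , entry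
      where
      open Mates cl G bip M pm
      entry : ∀ i j → M (A i) (B j) ≡ does (to i FP.≟ j)
      entry i j with to i FP.≟ j
      ... | yes refl = trans (cong (M (A i)) (proj₂ (A-mate i))) (M-mate (A i))
      ... | no ≢j    = BP.¬-not λ t → ≢j (B-injective (trans (proj₂ (A-mate i)) (sym (mate-unique t))))

    matching-⊑ : ∀ {M π} → IsPM G M → HasMatrix M π → π ⊑ E
    matching-⊑ {M} {π} pm mat i = proj₂ (proj₁ pm) _ _ (HasMatrix-entry {M} {π} mat)

    fromMat-⊆ : ∀ T → T ⊆M E → fromMat T ⊆E G
    fromMat-⊆ T T⊆E = fromMat-sym T , ⊆-from-matrix (fromMat-sym T) (Graph.sym G) (fromMat-coloured T)
      λ i j t → T⊆E i j (trans (sym (fromMat-AB T i j)) t)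

    fromPerm-matching : ∀ π → π ⊑ E → IsPM G (fromPerm π)
    fromPerm-matching π π⊑E = fromMat-⊆ (permMat π) (λ i j t → subst (λ k → E i k ≡ true) (permMat-entry π t) (π⊑E i)) ,
      λ v → partner v (vertex v)
      where
      partner : ∀ v → Vertex v → ∃ λ w → fromPerm π v w ≡ true × (∀ k → fromPerm π v k ≡ true → k ≡ w)
      partner _ (inA i) = B (π ⟨$⟩ʳ i) , trans (fromMat-AB (permMat π) i _) (permMat-diag π i) , only
        where
        only : ∀ k → fromPerm π (A i) k ≡ true → k ≡ B (π ⟨$⟩ʳ i)
        only k t with vertex k
        ... | inA l = contradiction (trans (A-true i) (sym (A-true l))) (fromMat-coloured (permMat π) _ _ t)
        ... | inB j = cong B (sym (permMat-entry π (trans (sym (fromMat-AB (permMat π) i j)) t)))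
      partner _ (inB j) = A (π ⟨$⟩ˡ j) ,
        trans (fromMat-BA (permMat π) _ j) (dec-true (π ⟨$⟩ʳ (π ⟨$⟩ˡ j) FP.≟ j) (inverseʳ π)) , only
        where
        only : ∀ k → fromPerm π (B j) k ≡ true → k ≡ A (π ⟨$⟩ˡ j)
        only k t with vertex k
        ... | inB l = contradiction (trans (B-false j) (sym (B-false l))) (fromMat-coloured (permMat π) _ _ t)
        ... | inA i = cong A (trans (sym (inverseˡ π))
          (cong (π ⟨$⟩ˡ_) (permMat-entry π (trans (sym (fromMat-BA (permMat π) i j)) t))))

    matching-coloured : ∀ {M} → M ⊆E G → Coloured c M
    matching-coloured (_ , sub) u v t = bip u v (sub u v t)

    same-matrix : ∀ {M₁ M₂ π₁ π₂} → M₁ ⊆E G → M₂ ⊆E G → HasMatrix M₁ π₁ → HasMatrix M₂ π₂ →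
      (∀ i → π₁ ⟨$⟩ʳ i ≡ π₂ ⟨$⟩ʳ i) → M₁ ≈E M₂
    same-matrix {M₁} {M₂} {π₁} {π₂} s₁ s₂ m₁ m₂ eq u v =
      BP.⇔→≡ {z = true} (mk⇔ (⊆-from-matrix {M₁} {M₂} (proj₁ s₁) (proj₁ s₂) (matching-coloured s₁) (λ i j t → trans (sym (same i j)) t) u v)
           (⊆-from-matrix {M₂} {M₁} (proj₁ s₂) (proj₁ s₁) (matching-coloured s₂) (λ i j t → trans (same i j) t) u v))
      where
      same : ∀ i j → M₁ (A i) (B j) ≡ M₂ (A i) (B j)
      same i j = trans (m₁ i j) (trans (cong (λ k → does (k FP.≟ j)) (eq i)) (sym (m₂ i j)))

    HasMatrix-unique : ∀ {M₁ M₂ π₁ π₂} → M₁ ≈E M₂ → HasMatrix M₁ π₁ → HasMatrix M₂ π₂ →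
      ∀ i → π₁ ⟨$⟩ʳ i ≡ π₂ ⟨$⟩ʳ i
    HasMatrix-unique {M₁} {M₂} {π₁} {π₂} eq m₁ m₂ i = permMat-entry π₁
      (trans (sym (m₁ i _)) (trans (eq (A i) _) (HasMatrix-entry {M₂} {π₂} m₂)))

    uniquePM⇒unique : ∀ {M π} → UniquePM G → IsPM G M → HasMatrix M π → Unique E π
    uniquePM⇒unique {M} {π} (_ , uniq) pm mat σ σ⊑ = HasMatrix-unique {fromPerm σ} {M} {σ} {π}
      (uniq (fromPerm σ) M (fromPerm-matching σ σ⊑) pm) (fromPerm-matrix σ) mat

    unique⇒uniquePM : ∀ π → π ⊑ E → Unique E π → UniquePM G
    unique⇒uniquePM π π⊑ uniq = (fromPerm π , fromPerm-matching π π⊑) , same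
      where
      same : ∀ M₁ M₂ → IsPM G M₁ → IsPM G M₂ → M₁ ≈E M₂
      same M₁ M₂ pm₁ pm₂ with π₁ , m₁ ← matching-perm pm₁ | π₂ , m₂ ← matching-perm pm₂ =
        same-matrix {M₁} {M₂} {π₁} {π₂} (proj₁ pm₁) (proj₁ pm₂) m₁ m₂ λ i →
          trans (uniq π₁ (matching-⊑ {M₁} {π₁} pm₁ m₁) i) (sym (uniq π₂ (matching-⊑ {M₂} {π₂} pm₂ m₂) i))

  module _ (G : Graph (n + n)) (bip : Coloured c (adj G)) where

    private
      E = toMat (adj G)

    complement : Mat n → Mat n
    complement H i j = E i j ∧ not (H i j)

    complement-⊆ : ∀ H → complement H ⊆M E
    complement-⊆ H i j t with E i j
    ... | true = refl

    complement-outside : ∀ H {i j} → complement H i j ≡ true → H i j ≡ false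
    complement-outside H {i} {j} t with E i j | H i j
    ... | true | false = refl

    outside-complement : ∀ H {i j} → E i j ≡ true → H i j ≡ false → complement H i j ≡ true
    outside-complement H e h rewrite e | h = refl

    removed : Mat n → EdgeSet (n + n)
    removed H = fromMat (complement H)

    size-complement : ∀ {S} → S ⊆E G → size S + cnt (complement (toMat S)) ≡ cnt E
    size-complement {S} S⊆G = trans
      (cong (_+ cnt (complement (toMat S))) (size-cnt S (proj₁ S⊆G) (λ u v t → bip u v (proj₂ S⊆G u v t))))
      (cnt-minus {H = toMat S} λ i j → proj₂ S⊆G (A i) (B j))

    size-removed : ∀ H → H ⊆M E → size (removed H) + cnt H ≡ cnt E
    size-removed H H⊆E = trans (cong (_+ cnt H) (trans
      (size-cnt (removed H) (fromMat-sym (complement H)) (fromMat-coloured (complement H)))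
      (sum-cong-≗ {n} λ i → sum-cong-≗ {n} λ j → cong bit (fromMat-AB (complement H) i j))))
      (trans (+-comm (cnt (complement H)) (cnt H)) (cnt-minus {H = H} H⊆E))

    deleted-coloured : ∀ S → Coloured c (adj (G ─ S))
    deleted-coloured S u v t = bip u v (BP.∧-conicalˡ (adj G u v) _ t)

    deleted-matrix : ∀ S → IsSym S → ∀ i j → toMat (adj (G ─ S)) i j ≡ complement (toMat S) i j
    deleted-matrix S symS i j = cong (λ b → E i j ∧ not b)
      (trans (cong (S (A i) (B j) ∧_) (symS (B j) (A i))) (BP.∧-idem (S (A i) (B j))))

    deleted-removed : ∀ H → H ⊆M E → ∀ i j → toMat (adj (G ─ removed H)) i j ≡ H i j
    deleted-removed H H⊆E i j = trans (deleted-matrix (removed H) (fromMat-sym (complement H)) i j)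
      (trans (cong (λ b → E i j ∧ not b) (fromMat-AB (complement H) i j)) (involutive (E i j) (H i j) (H⊆E i j)))
      where
      involutive : ∀ e h → (h ≡ true → e ≡ true) → e ∧ not (e ∧ not h) ≡ h
      involutive false false _ = refl
      involutive false true  f = f refl
      involutive true  h     _ = BP.not-involutive h

    unique-cong : ∀ (H H′ : Mat n) π → (∀ i j → H i j ≡ H′ i j) → Unique H′ π → Unique H π
    unique-cong H H′ π eq uniq σ σ⊑ = uniq σ λ i → trans (sym (eq i _)) (σ⊑ i)

    -- `H` is what deleting `S` leaves. Disjointness keeps `M` inside, so `M` is its unique perfect
    -- matching, and minimising `S` amounts to maximising `H`.
    afCand-matrix : ∀ {M π S} → IsPM G M → HasMatrix M π → AfCand G M S →
      ∃ λ H → H ⊆M E × π ⊑ H × Unique H π × size S + cnt H ≡ cnt E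
    afCand-matrix {M} {π} {S} pm mat (S⊆G , disjoint , uniq) =
      H , complement-⊆ (toMat S) , (λ i → outside-complement (toMat S) (matching-⊑ G bip {M} {π} pm mat i) (S-off (HasMatrix-entry {M} {π} mat))) ,
      unique-cong H (toMat (adj (G ─ S))) π (λ i j → sym (deleted-matrix S (proj₁ S⊆G) i j))
        (uniquePM⇒unique (G ─ S) (deleted-coloured S) {M} {π} uniq pm′ mat) ,
      size-complement S⊆G
      where
      H = complement (toMat S)
      S-off : ∀ {u v} → M u v ≡ true → S u v ≡ false
      S-off {u} {v} m = BP.¬-not λ s → true≢false (trans (sym m) (disjoint u v s))
      pm′ : IsPM (G ─ S) M
      pm′ = (proj₁ (proj₁ pm) , λ u v m → cong₂ _∧_ (proj₂ (proj₁ pm) u v m)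
        (cong (λ b → not (b ∧ S v u)) (S-off m))) , proj₂ pm

    matrix-afCand : ∀ {M π H} → IsPM G M → HasMatrix M π → H ⊆M E → π ⊑ H → Unique H π →
      AfCand G M (removed H)
    matrix-afCand {M} {π} {H} pm mat H⊆E π⊑H uniq = fromMat-⊆ G bip (complement H) (complement-⊆ H) , disjoint ,
      unique⇒uniquePM (G ─ removed H) (deleted-coloured (removed H)) π
        (λ i → trans (deleted-removed H H⊆E i _) (π⊑H i)) (unique-cong (toMat (adj (G ─ removed H))) H π (deleted-removed H H⊆E) uniq)
      where
      avoid : ∀ i j → removed H (A i) (B j) ≡ true → M (A i) (B j) ≡ false
      avoid i j s = BP.¬-not λ m → true≢false (trans
        (sym (subst (λ k → H i k ≡ true) (permMat-entry π (trans (sym (mat i j)) m)) (π⊑H i)))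
        (complement-outside H (trans (sym (fromMat-AB (complement H) i j)) s)))
      disjoint : Disjoint (removed H) M
      disjoint u v s with opposite u v (fromMat-coloured (complement H) u v s)
      ... | AB i j = avoid i j s
      ... | BA j i = trans (proj₁ (proj₁ pm) (B j) (A i)) (avoid i j (trans (fromMat-sym (complement H) (A i) (B j)) s))

    -- Matchings that agree off the complement of `S` contain the same edges of `S`, which is the
    -- premise of the forcing property.
    gfCand-coforcing : ∀ {S} → GfCand G S → CoForcing E (complement (toMat S))
    gfCand-coforcing {S} (S⊆G , forcing) σ τ σ⊑ τ⊑ στ τσ =
      HasMatrix-unique G bip {fromPerm σ} {fromPerm τ} {σ} {τ}
        (forcing (fromPerm σ) (fromPerm τ) (fromPerm-matching G bip σ σ⊑) (fromPerm-matching G bip τ τ⊑) agree)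
        (fromPerm-matrix σ) (fromPerm-matrix τ)
      where
      inside : ∀ i j → S (A i) (B j) ≡ true → complement (toMat S) i j ≡ false
      inside i j s = BP.¬-not λ t → true≢false (trans (sym s) (complement-outside (toMat S) {i} {j} t))
      follow : ∀ σ τ → AgreeOff (complement (toMat S)) σ τ → ∀ i j → S (A i) (B j) ≡ true →
        permMat σ i j ≡ true → permMat τ i j ≡ true
      follow σ τ στ i j s t with refl ← permMat-entry σ {i} {j} t =
        dec-true (τ ⟨$⟩ʳ i FP.≟ _) (στ i (inside i _ s))
      agreeAB : ∀ i j → S (A i) (B j) ≡ true → fromPerm σ (A i) (B j) ≡ fromPerm τ (A i) (B j)
      agreeAB i j s = trans (fromPerm-matrix σ i j) (trans
        (BP.⇔→≡ {z = true} (mk⇔ (follow σ τ στ i j s) (follow τ σ τσ i j s))) (sym (fromPerm-matrix τ i j)))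
      agree : ∀ u v → S u v ≡ true → fromPerm σ u v ≡ fromPerm τ u v
      agree u v s with opposite u v (bip u v (proj₂ S⊆G u v s))
      ... | AB i j = agreeAB i j s
      ... | BA j i = trans (fromMat-sym (permMat σ) (B j) (A i)) (trans
        (agreeAB i j (trans (proj₁ S⊆G (A i) (B j)) s)) (fromMat-sym (permMat τ) (A i) (B j)))

    coforcing-gfCand : ∀ {T} → CoForcing E T → GfCand G (removed T)
    coforcing-gfCand {T} cf = fromMat-⊆ G bip (complement T) (complement-⊆ T) , forcing
      where
      forcing : ∀ M₁ M₂ → IsPM G M₁ → IsPM G M₂ → (∀ u v → removed T u v ≡ true → M₁ u v ≡ M₂ u v) → M₁ ≈E M₂
      forcing M₁ M₂ pm₁ pm₂ agree with π₁ , m₁ ← matching-perm G bip pm₁ | π₂ , m₂ ← matching-perm G bip pm₂ =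
        same-matrix G bip {M₁} {M₂} {π₁} {π₂} (proj₁ pm₁) (proj₁ pm₂) m₁ m₂
          (cf π₁ π₂ (matching-⊑ G bip {M₁} {π₁} pm₁ m₁) (matching-⊑ G bip {M₂} {π₂} pm₂ m₂)
            (follow {M₁} {M₂} {π₁} {π₂} pm₁ m₁ m₂ agree)
            (follow {M₂} {M₁} {π₂} {π₁} pm₂ m₂ m₁ λ u v r → sym (agree u v r)))
        where
        follow : ∀ {M₁ M₂ π₁ π₂} → IsPM G M₁ → HasMatrix M₁ π₁ → HasMatrix M₂ π₂ →
          (∀ u v → removed T u v ≡ true → M₁ u v ≡ M₂ u v) → AgreeOff T π₁ π₂
        follow {M₁} {M₂} {π₁} {π₂} pm₁ m₁ m₂ agree i out = permMat-entry π₂ (trans (sym (m₂ i _)) (trans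
          (sym (agree _ _ (trans (fromMat-AB (complement T) i _) (outside-complement T (matching-⊑ G bip {M₁} {π₁} pm₁ m₁ i) out))))
          (HasMatrix-entry {M₁} {π₁} m₁)))

-- Spanning trees

cnt-mono-< : ∀ {n} {X Y : Mat n} → X ⊆M Y → ∀ i j → X i j ≡ false → Y i j ≡ true → cnt X < cnt Y
cnt-mono-< X⊆Y i j x y = sum-mono-< (λ k → weight-mono (X⊆Y k)) i (weight-mono-< (X⊆Y i) j x y)

weight-update : ∀ {n} {f g : Fin n → Bool} c → (∀ i → i ≢ c → f i ≡ true → g i ≡ true) → weight f ≤ 1 + weight g
weight-update {f = f} {g} c f⇒g = begin
  weight f                                              ≤⟨ sum-mono (λ i → entry i (i FP.≟ c)) ⟩
  sum (λ i → bit (does (i FP.≟ c)) + bit (g i))         ≡⟨ ∑-distrib-+ (λ i → bit (does (i FP.≟ c))) (bit ∘ g) ⟩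
  weight (λ i → does (i FP.≟ c)) + weight g             ≤⟨ +-monoˡ-≤ (weight g) (weight-single (λ i → does (i FP.≟ c)) c (λ i → does-true (i FP.≟ c))) ⟩
  1 + weight g                                          ∎
  where
  open ≤-Reasoning
  entry : ∀ i (d : Dec (i ≡ c)) → bit (f i) ≤ bit (does d) + bit (g i)
  entry i (yes _)  = ≤-trans (bit-mono {f i} {true} (λ _ → refl)) (m≤m+n 1 (bit (g i)))
  entry i (no i≢c) = bit-mono (f⇒g i i≢c)

-- Reading the path backwards from `v`, the first edge whose earlier end lies in `X` crosses.
crossing : ∀ {m} (G : Graph m) (X : Fin m → Bool) {r v} → X r ≡ true → X v ≡ false → Reach G r v →
  ∃₂ λ u w → X u ≡ true × X w ≡ false × adj G u w ≡ true
crossing G X Xr Xv here = contradiction (trans (sym Xr) Xv) true≢false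
crossing G X Xr Xv (step {j} {k} r e) with X j in Xj
... | true  = j , k , Xj , Xv , e
... | false = crossing G X Xr Xj r

-- If only one matching used `u`, the partner of `v` in the other would be a partner in both, giving
-- `v` two partners in the first.
matchings-agree-at : ∀ {m} {G : Graph m} {M₁ M₂} → IsPM G M₁ → IsPM G M₂ → ∀ v u →
  (∀ w → w ≢ u → M₁ v w ≡ M₂ v w) → M₁ v u ≡ M₂ v u
matchings-agree-at {G = G} {M₁} {M₂} pm₁ pm₂ v u agree =
  BP.⇔→≡ {z = true} (mk⇔ (transfer pm₁ pm₂ agree) (transfer pm₂ pm₁ (λ w w≢u → sym (agree w w≢u))))
  where
  transfer : ∀ {M₁ M₂} → IsPM G M₁ → IsPM G M₂ → (∀ w → w ≢ u → M₁ v w ≡ M₂ v w) →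
    M₁ v u ≡ true → M₂ v u ≡ true
  transfer {M₁} {M₂} pm₁ pm₂ agree t with proj₂ pm₂ v
  ... | w , M₂vw , _ with w FP.≟ u
  ...   | yes refl = M₂vw
  ...   | no w≢u   = contradiction
    (trans (proj₂ (proj₂ (proj₂ pm₁ v)) w (trans (agree w w≢u) M₂vw))
           (sym (proj₂ (proj₂ (proj₂ pm₁ v)) u t))) w≢u

module SpanningTree {n} {c : Fin (n + n) → Bool} (cl : Classes c n n) (G : Graph (n + n))
  (bip : Coloured c (adj G)) where

  open Classes cl
  open Matrices cl

  -- A tree on the vertex set `X`: `large` bounds |X| by |T| + 1 without subtraction, and `peel`,
  -- saying that the complement of `T` is forcing, stands in for acyclicity.
  record Tree (X : Fin (n + n) → Bool) : Set where
    field
      T      : EdgeSet (n + n)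
      T⊆G    : T ⊆E G
      within : ∀ u v → T u v ≡ true → X u ≡ true
      large  : n + n ≤ weight (not ∘ X) + (cnt (toMat T) + 1)
      peel   : ∀ M₁ M₂ → IsPM G M₁ → IsPM G M₂ → (∀ u v → T u v ≡ false → M₁ u v ≡ M₂ u v) → M₁ ≈E M₂

  root-tree : ∀ r → Tree (λ v → does (v FP.≟ r))
  root-tree r = record
    { T      = λ _ _ → false
    ; T⊆G    = (λ _ _ → refl) , λ _ _ ()
    ; within = λ _ _ ()
    ; large  = ≤-trans (≤-trans (≤-reflexive (sym (trans (sum-const (n + n) 1) (*-identityʳ (n + n)))))
        (≤-trans (weight-update {f = λ _ → true} r λ i i≢r _ → cong not (dec-false (i FP.≟ r) i≢r))
          (≤-reflexive (+-comm 1 _)))) (+-monoʳ-≤ (weight (λ v → not (does (v FP.≟ r)))) (m≤n+m 1 (cnt {n} (λ _ _ → false))))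
    ; peel   = λ M₁ M₂ _ _ agree u v → agree u v refl
    }

  -- The new vertex w is a leaf, where two matchings agreeing on all other edges agree as well.
  grow : ∀ {X} → Tree X → ∀ u w → X u ≡ true → X w ≡ false → adj G u w ≡ true →
    Tree (λ v → X v ∨ does (v FP.≟ w))
  grow {X} tree u w Xu Xw e = record
    { T      = T′
    ; T⊆G    = sym′ , λ x y t → sub x y (case x y t)
    ; within = λ x y t → inside x y (case x y t)
    ; large  = ≤-trans large (≤-trans (+-monoˡ-≤ (cnt (toMat T) + 1) (weight-update w λ i i≢w Xi → trans (cong (not ∘ (X i ∨_)) (dec-false (i FP.≟ w) i≢w)) (trans (cong not (BP.∨-identityʳ (X i))) Xi)))
        (≤-trans (≤-reflexive (sym (+-suc (weight (not ∘ X′)) (cnt (toMat T) + 1))))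
          (+-monoʳ-≤ (weight (not ∘ X′)) (+-monoˡ-≤ 1 more))))
    ; peel   = λ M₁ M₂ pm₁ pm₂ agree → peel M₁ M₂ pm₁ pm₂ (agree-T pm₁ pm₂ agree)
    }
    where
    open Tree tree
    X′ : Fin (n + n) → Bool
    X′ v = X v ∨ does (v FP.≟ w)
    New : Fin (n + n) → Fin (n + n) → Set
    New x y = (x ≡ u × y ≡ w) ⊎ (x ≡ w × y ≡ u)
    new? : ∀ x y → Dec (New x y)
    new? x y = (x FP.≟ u ×-dec y FP.≟ w) ⊎-dec (x FP.≟ w ×-dec y FP.≟ u)
    T′ : EdgeSet (n + n)
    T′ x y = T x y ∨ does (new? x y)
    case : ∀ x y → T′ x y ≡ true → T x y ≡ true ⊎ New x y
    case x y t with T x y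
    ... | true  = inj₁ refl
    ... | false = inj₂ (does-true (new? x y) t)
    new : ∀ x y → New x y → T′ x y ≡ true
    new x y d = trans (cong (T x y ∨_) (dec-true (new? x y) d)) (BP.∨-zeroʳ (T x y))
    old : ∀ x y → T x y ≡ true → T′ x y ≡ true
    old x y t = cong (_∨ does (new? x y)) t
    flipped : ∀ x y → T′ x y ≡ true → T′ y x ≡ true
    flipped x y t with case x y t
    ... | inj₁ s        = old y x (trans (proj₁ T⊆G y x) s)
    ... | inj₂ (inj₁ (p , q)) = new y x (inj₂ (q , p))
    ... | inj₂ (inj₂ (p , q)) = new y x (inj₁ (q , p))
    sym′ : IsSym T′
    sym′ x y = BP.⇔→≡ {z = true} (mk⇔ (flipped x y) (flipped y x))
    sub : ∀ x y → T x y ≡ true ⊎ New x y → adj G x y ≡ true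
    sub x y (inj₁ t)                    = proj₂ T⊆G x y t
    sub x y (inj₂ (inj₁ (refl , refl))) = e
    sub x y (inj₂ (inj₂ (refl , refl))) = trans (Graph.sym G w u) e
    inside : ∀ x y → T x y ≡ true ⊎ New x y → X′ x ≡ true
    inside x y (inj₁ t)                    = cong (_∨ does (x FP.≟ w)) (within x y t)
    inside x y (inj₂ (inj₁ (refl , refl))) = cong (_∨ does (x FP.≟ w)) Xu
    inside x y (inj₂ (inj₂ (refl , refl))) = trans (cong (X w ∨_) (dec-true (w FP.≟ w) refl)) (BP.∨-zeroʳ (X w))
    T-w : ∀ y → T w y ≡ false
    T-w y = BP.¬-not λ t → true≢false (trans (sym (within w y t)) Xw)
    u≢w : u ≢ w
    u≢w refl = true≢false (trans (sym Xu) Xw)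
    more : 1 + cnt (toMat T) ≤ cnt (toMat T′)
    more with opposite u w (bip u w e)
    ... | AB i j = cnt-mono-< {X = toMat T} {toMat T′} (λ k l → old (A k) (B l)) i j
      (trans (proj₁ T⊆G (A i) (B j)) (T-w (A i))) (new (A i) (B j) (inj₁ (refl , refl)))
    ... | BA j i = cnt-mono-< {X = toMat T} {toMat T′} (λ k l → old (A k) (B l)) i j
      (T-w (B j)) (new (A i) (B j) (inj₂ (refl , refl)))
    leaf : ∀ {M₁ M₂} → IsPM G M₁ → IsPM G M₂ → (∀ x y → T′ x y ≡ false → M₁ x y ≡ M₂ x y) →
      M₁ w u ≡ M₂ w u
    leaf pm₁ pm₂ agree = matchings-agree-at {G = G} pm₁ pm₂ w u λ y y≢u → agree w y (cong₂ _∨_ (T-w y)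
      (dec-false (new? w y) λ { (inj₁ (w≡u , _)) → u≢w (sym w≡u) ; (inj₂ (_ , y≡u)) → y≢u y≡u }))
    agree-T : ∀ {M₁ M₂} → IsPM G M₁ → IsPM G M₂ → (∀ x y → T′ x y ≡ false → M₁ x y ≡ M₂ x y) →
      ∀ x y → T x y ≡ false → M₁ x y ≡ M₂ x y
    agree-T pm₁ pm₂ agree x y out = cases (new? x y)
      where
      cases : Dec (New x y) → _
      cases (yes (inj₁ (refl , refl))) =
        trans (proj₁ (proj₁ pm₁) u w) (trans (leaf pm₁ pm₂ agree) (proj₁ (proj₁ pm₂) w u))
      cases (yes (inj₂ (refl , refl))) = leaf pm₁ pm₂ agree
      cases (no ¬new) = agree x y (cong₂ _∨_ out (dec-false (new? x y) ¬new))

  spanning : Connected G → ∀ r X → X r ≡ true → Tree X → Acc _<_ (weight (not ∘ X)) →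
    ∃ λ X′ → (∀ v → X′ v ≡ true) × Tree X′
  spanning conn r X Xr tree (acc rec) with FP.any? (λ v → X v BP.≟ false)
  ... | no none = X , (λ v → BP.¬-not λ Xv → none (v , Xv)) , tree
  ... | yes (v , Xv) with u , w , Xu , Xw , e ← crossing G X Xr Xv (conn r v) =
    spanning conn r (λ v → X v ∨ does (v FP.≟ w)) (cong (_∨ does (r FP.≟ w)) Xr) (grow tree u w Xu Xw e)
      (rec (weight-mono-< shrink w (cong not (trans (cong (X w ∨_) (dec-true (w FP.≟ w) refl)) (BP.∨-zeroʳ (X w)))) (cong not Xw)))
    where
    shrink : ∀ v → not (X v ∨ does (v FP.≟ w)) ≡ true → not (X v) ≡ true
    shrink v t with X v
    ... | false = refl

  small-gfCand : Connected G → Fin (n + n) → ∃ λ S → GfCand G S × size S + (n + n) ≤ cnt (toMat (adj G)) + 1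
  small-gfCand conn r
    with X , all , tree ← spanning conn r _ (dec-true (r FP.≟ r) refl) (root-tree r) (<-wellFounded _) =
    S , (S⊆G , forcing) , bound
    where
    open Tree tree
    S : EdgeSet (n + n)
    S u v = adj G u v ∧ not (T u v)
    S⊆G : S ⊆E G
    S⊆G = (λ u v → cong₂ (λ a b → a ∧ not b) (Graph.sym G u v) (proj₁ T⊆G u v)) ,
      λ u v → BP.∧-conicalˡ (adj G u v) _
    forcing : ∀ M₁ M₂ → IsPM G M₁ → IsPM G M₂ → (∀ u v → S u v ≡ true → M₁ u v ≡ M₂ u v) → M₁ ≈E M₂
    forcing M₁ M₂ pm₁ pm₂ agree = peel M₁ M₂ pm₁ pm₂ off-tree
      where
      absent : ∀ {M u v} → IsPM G M → adj G u v ≡ false → M u v ≡ false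
      absent pm no-edge = BP.¬-not λ t → true≢false (trans (sym (proj₂ (proj₁ pm) _ _ t)) no-edge)
      -- A pair outside `T` lies in `S` or is no edge of `G`, in which case both matchings avoid it.
      off-tree : ∀ u v → T u v ≡ false → M₁ u v ≡ M₂ u v
      off-tree u v out with adj G u v in e
      ... | true  = agree u v (cong₂ (λ a b → a ∧ not b) e out)
      ... | false = trans (absent {M₁} pm₁ e) (sym (absent {M₂} pm₂ e))
    bound : size S + (n + n) ≤ cnt (toMat (adj G)) + 1
    bound = begin
      size S + (n + n)                          ≤⟨ +-monoʳ-≤ (size S) large ⟩
      size S + (weight (not ∘ X) + (cnt (toMat T) + 1))
        ≡⟨ cong₂ (λ s w → s + (w + (cnt (toMat T) + 1))) (size-cnt S (proj₁ S⊆G) (λ u v t → bip u v (proj₂ S⊆G u v t))) (weight-none (cong not ∘ all)) ⟩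
      cnt (toMat S) + (cnt (toMat T) + 1)       ≡⟨ +-assoc (cnt (toMat S)) (cnt (toMat T)) 1 ⟨
      cnt (toMat S) + cnt (toMat T) + 1         ≡⟨ cong (_+ 1) (+-comm (cnt (toMat S)) (cnt (toMat T))) ⟩
      cnt (toMat T) + cnt (toMat S) + 1         ≡⟨ cong (_+ 1) (cnt-minus {H = toMat T} λ i j → proj₂ T⊆G (A i) (B j)) ⟩
      cnt (toMat (adj G)) + 1                   ∎
      where open ≤-Reasoning

-- Comparing the two numbers

module Comparison {n} {c : Fin (n + n) → Bool} (cl : Classes c n n) (G : Graph (n + n))
  (bip : Coloured c (adj G)) where

  open Matrices cl
  open Matchings cl

  E : Mat n
  E = toMat (adj G)

  -- For a matching attaining `a`, the graph `H` keeps at least as many edges as the complement of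
  -- an optimal forcing set, so no more edges are deleted.
  af≤gf : ∀ {a g} → IsAf G a → IsGf G g → a ≤ g
  af≤gf ((M , pm , _ , minimal) , _) ((S , cand , refl) , _)
    with π , mat ← matching-perm G bip pm
    with H , H⊆E , π⊑H , uniq , le ← unique-of-coforcing E (complement G bip (toMat S)) π
           (complement-⊆ G bip (toMat S)) (matching-⊑ G bip {M} {π} pm mat) (gfCand-coforcing G bip cand)
    = ≤-trans (minimal (removed G bip H) (matrix-afCand G bip {M} {π} {H} pm mat H⊆E π⊑H uniq))
        (+-cancelʳ-≤ (cnt H) _ _ (≤-trans
          (≤-reflexive (trans (size-removed G bip H H⊆E) (sym (size-complement G bip (proj₁ cand)))))
          (+-monoʳ-≤ (size S) le)))

  afCand-size : ∀ {M π S} → IsPM G M → HasMatrix M π → AfCand G M S → 2 * cnt E ≤ 2 * size S + n * suc n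
  afCand-size {M} {π} {S} pm mat cand
    with H , _ , π⊑H , uniq , total ← afCand-matrix G bip {M} {π} {S} pm mat cand = begin
    2 * cnt E                 ≡⟨ cong (2 *_) total ⟨
    2 * (size S + cnt H)      ≡⟨ *-distribˡ-+ 2 (size S) (cnt H) ⟩
    2 * size S + 2 * cnt H    ≤⟨ +-monoʳ-≤ (2 * size S) (unique-size H π π⊑H uniq) ⟩
    2 * size S + n * suc n    ∎
    where open ≤-Reasoning

  af-lower : ∀ {a} → IsAf G a → 2 * cnt E ≤ 2 * a + n * suc n
  af-lower ((M , pm , (S , cand , refl) , _) , _) with π , mat ← matching-perm G bip pm =
    afCand-size {M} {π} pm mat cand

  gf-upper : ∀ {g} → Connected G → Fin (n + n) → IsGf G g → g + (n + n) ≤ cnt E + 1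
  gf-upper conn r (_ , minimal) with S , cand , le ← SpanningTree.small-gfCand cl G bip conn r =
    ≤-trans (+-monoˡ-≤ (n + n) (minimal S cand)) le

  -- As `a` is the maximum over all matchings, a minimum anti-forcing set of any matching leaves at
  -- least n(n+1)/2 edges, the extremal number; what is left is a half graph.
  orderable : ∀ {a} → IsAf G a → n * suc n + 2 * a ≤ 2 * cnt E → Orderable E
  orderable {a} (_ , maximal) tight π π⊑E none = minimum (AfCand G M) (removed G bip (permMat π)) start
    λ (b , isMin) → found b isMin
    where
    M = fromPerm π
    pm : IsPM G M
    pm = fromPerm-matching G bip π π⊑E
    mat : HasMatrix M π
    mat = fromPerm-matrix π
    -- Keeping nothing but `M` gives a first candidate from which the descent can start.
    start : AfCand G M (removed G bip (permMat π))
    start = matrix-afCand G bip {M} {π} {permMat π} pm mat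
      (λ i j t → subst (λ k → E i k ≡ true) (permMat-entry π t) (π⊑E i)) (permMat-diag π)
      (λ σ σ⊑ i → sym (permMat-entry π (σ⊑ i)))
    large : ∀ b h → b ≤ a → b + h ≡ cnt E → n * suc n ≤ 2 * h
    large b h b≤a total = +-cancelʳ-≤ (2 * b) _ _ (begin
      n * suc n + 2 * b      ≤⟨ +-monoʳ-≤ (n * suc n) (*-monoʳ-≤ 2 b≤a) ⟩
      n * suc n + 2 * a      ≤⟨ tight ⟩
      2 * cnt E              ≡⟨ cong (2 *_) (trans (sym total) (+-comm b h)) ⟩
      2 * (h + b)            ≡⟨ *-distribˡ-+ 2 h b ⟩
      2 * h + 2 * b          ∎)
      where open ≤-Reasoning
    found : ∀ b → IsAfM G M b → ⊥
    found b isMin@((S , cand , refl) , _)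
      with H , H⊆E , π⊑H , uniq , total ← afCand-matrix G bip {M} {π} {S} pm mat cand
      with ρ , half ← unique-extremal H π π⊑H uniq (large b (cnt H) (maximal M b pm isMin) total)
      = none (ρ , λ i j j≤i → H⊆E _ _ (half i j j≤i))

  -- The complement would be a global forcing set of at most e - 2n edges, whereas tightness puts
  -- `g` at e - 2n + 1 or more.
  no-large-coforcing : ∀ {g T} → IsGf G g → cnt E + 1 ≤ g + (n + n) → T ⊆M E → CoForcing E T →
    2 * n ≤ cnt T → ⊥
  no-large-coforcing {g} {T} (_ , minimal) tight T⊆E cf large = <⇒≱ (n<1+n (cnt E)) (begin
    suc (cnt E)                             ≡⟨ +-comm 1 (cnt E) ⟩
    cnt E + 1                               ≤⟨ tight ⟩
    g + (n + n)                             ≡⟨ cong (λ k → g + (n + k)) (+-identityʳ n) ⟨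
    g + 2 * n                               ≤⟨ +-mono-≤ (minimal (removed G bip T) (coforcing-gfCand G bip cf)) large ⟩
    size (removed G bip T) + cnt T          ≡⟨ size-removed G bip T T⊆E ⟩
    cnt E                                   ∎)
    where open ≤-Reasoning

  module _ (full : ∀ i j → E i j ≡ true) where

    cnt-full : cnt E ≡ n * n
    cnt-full = trans (sum-cong-≗ {n} λ i → trans (sum-cong-≗ {n} λ j → cong bit (full i j))
      (trans (sum-const n 1) (*-identityʳ n))) (sum-const n n)

    af-upper : ∀ {a} → IsAf G a → 2 * a + n * suc n ≤ 2 * (n * n)
    af-upper {a} ((M , pm , _ , minimal) , _)
      with π , mat ← matching-perm G bip pm
      with H , π⊑H , uniq , large ← triangular π = begin
      2 * a + n * suc n                              ≤⟨ +-mono-≤ (*-monoʳ-≤ 2 (minimal (removed G bip H) (matrix-afCand G bip {M} {π} {H} pm mat (λ i j _ → full i j) π⊑H uniq))) large ⟩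
      2 * size (removed G bip H) + 2 * cnt H         ≡⟨ *-distribˡ-+ 2 (size (removed G bip H)) (cnt H) ⟨
      2 * (size (removed G bip H) + cnt H)           ≡⟨ cong (2 *_) (trans (size-removed G bip H λ i j _ → full i j) cnt-full) ⟩
      2 * (n * n)                                    ∎
      where open ≤-Reasoning

  -- `small` is a hypothesis because `complete-coforcing-size` speaks of positive orders, while `n`
  -- is arbitrary here.
  complete-gf-lower : ∀ {g} → (∀ i j → E i j ≡ true) → IsGf G g →
    (∀ T → CoForcing (complete n) T → cnt T + 1 ≤ 2 * n) → n * n + 1 ≤ g + 2 * n
  complete-gf-lower full ((S , cand , refl) , _) small = begin
    n * n + 1                     ≡⟨ cong (_+ 1) (trans (sym (cnt-full full)) (sym (size-complement G bip (proj₁ cand)))) ⟩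
    size S + cnt T + 1            ≡⟨ +-assoc (size S) (cnt T) 1 ⟩
    size S + (cnt T + 1)          ≤⟨ +-monoʳ-≤ (size S) (small T λ σ τ _ _ → gfCand-coforcing G bip cand σ τ (λ i → full i _) (λ i → full i _)) ⟩
    size S + 2 * n                ∎
    where
    open ≤-Reasoning
    T = complement G bip (toMat S)

-- Isomorphism with the complete bipartite graph

side-↑ˡ : ∀ {n} (i : Fin n) → side {n} (i ↑ˡ n) ≡ true
side-↑ˡ {n} i = dec-true (toℕ (i ↑ˡ n) <? n) (subst (_< n) (sym (FP.toℕ-↑ˡ i n)) (FP.toℕ<n i))

side-↑ʳ : ∀ {n} (j : Fin n) → side {n} (n ↑ʳ j) ≡ false
side-↑ʳ {n} j = dec-false (toℕ (n ↑ʳ j) <? n) (≤⇒≯ (subst (n ≤_) (sym (FP.toℕ-↑ʳ n j)) (m≤m+n n (toℕ j))))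

module _ {n} {c : Fin (n + n) → Bool} (cl : Classes c n n) (G : Graph (n + n))
  (bip : Coloured c (adj G)) where

  open Classes cl
  open Matrices cl

  full⇒≅K : (∀ i j → toMat (adj G) i j ≡ true) → G ≅ K n
  full⇒≅K full = permutation to from to∘from from∘to , λ u v → adjacency u v (vertex u) (vertex v)
    where
    to from : Fin (n + n) → Fin (n + n)
    to   = Fin.join n n ∘ locate
    from = Sum.[ A , B ]′ ∘ Fin.splitAt n
    locate-vertex : ∀ x → locate (Sum.[ A , B ]′ x) ≡ x
    locate-vertex (inj₁ i) = locate-A i
    locate-vertex (inj₂ j) = locate-B j
    to∘from : ∀ v → to (from v) ≡ v
    to∘from v = trans (cong (Fin.join n n) (locate-vertex (Fin.splitAt n v))) (FP.join-splitAt n n v)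
    from∘to : ∀ v → from (to v) ≡ v
    from∘to v = trans (cong Sum.[ A , B ]′ (FP.splitAt-join n n (locate v))) (located v)
    side-A : ∀ i → side {n} (to (A i)) ≡ true
    side-A i = trans (cong (side {n} ∘ Fin.join n n) (locate-A i)) (side-↑ˡ i)
    side-B : ∀ j → side {n} (to (B j)) ≡ false
    side-B j = trans (cong (side {n} ∘ Fin.join n n) (locate-B j)) (side-↑ʳ j)
    non-adjacent : ∀ u v → c u ≡ c v → adj G u v ≡ false
    non-adjacent u v eq = BP.¬-not λ e → bip u v e eq
    adjacency : ∀ u v → Vertex u → Vertex v → adj G u v ≡ side {n} (to u) xor side {n} (to v)
    adjacency _ _ (inA i) (inA j) = trans (non-adjacent _ _ (trans (A-true i) (sym (A-true j)))) (sym (cong₂ _xor_ (side-A i) (side-A j)))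
    adjacency _ _ (inA i) (inB j) = trans (full i j) (sym (cong₂ _xor_ (side-A i) (side-B j)))
    adjacency _ _ (inB j) (inA i) = trans (trans (Graph.sym G (B j) (A i)) (full i j)) (sym (cong₂ _xor_ (side-B j) (side-A i)))
    adjacency _ _ (inB i) (inB j) = trans (non-adjacent _ _ (trans (B-false i) (sym (B-false j)))) (sym (cong₂ _xor_ (side-B i) (side-B j)))

  -- Two vertices on the same side of K n have a common neighbour, hence the same colour.
  ≅K⇒full : Fin n → G ≅ K n → ∀ i j → toMat (adj G) i j ≡ true
  ≅K⇒full i₀ (f , iso) i j = by-sides (other-side (s (A i)))
    where
    s : Fin (n + n) → Bool
    s v = side {n} (Inverse.to f v)
    other-side : ∀ b → ∃ λ w → s w ≡ not b
    other-side true  = Inverse.from f (n ↑ʳ i₀) , trans (cong (side {n}) (Inverse.strictlyInverseˡ f _)) (side-↑ʳ i₀)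
    other-side false = Inverse.from f (i₀ ↑ˡ n) , trans (cong (side {n}) (Inverse.strictlyInverseˡ f _)) (side-↑ˡ i₀)
    neighbour : ∀ {v w} → s w ≡ not (s v) → c v ≢ c w
    neighbour {v} {w} eq = bip v w (trans (iso v w) (trans (cong (s v xor_) eq) (xor-not (s v))))
      where
      xor-not : ∀ b → b xor not b ≡ true
      xor-not true  = refl
      xor-not false = refl
    by-sides : (∃ λ w → s w ≡ not (s (A i))) → adj G (A i) (B j) ≡ true
    by-sides (w , eq) with s (A i) BP.≟ s (B j)
    ... | no s≢s = trans (iso (A i) (B j)) (xor-≢ s≢s)
      where
      xor-≢ : ∀ {a b} → a ≢ b → a xor b ≡ true
      xor-≢ {true}  {true}  a≢b = contradiction refl a≢b
      xor-≢ {true}  {false} _   = refl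
      xor-≢ {false} {true}  _   = refl
      xor-≢ {false} {false} a≢b = contradiction refl a≢b
    ... | yes eq′ = contradiction
      (trans (sym (A-true i)) (trans (trans (BP.¬-not (neighbour eq)) (sym (BP.¬-not (neighbour (trans eq (cong not eq′)))))) (B-false j)))
      true≢false

-- The two estimates 2e ≤ 2a + n(n+1) and g + 2n ≤ e + 1 with n = k + 3, and their equality case

module Arithmetic (k : ℕ) where

  private
    n : ℕ
    n = suc (suc (suc k))

    -- With n = k + 3 this is n(n + 1) + 2 = (n - 1)(n - 2) + 4n, which balances the doubled tree
    -- bound against the triangular one.
    identity : ∀ k x → x + suc (suc (suc k)) * suc (suc (suc (suc k))) + 2 ≡
      x + (suc (suc k) * suc k + 4 * suc (suc (suc k)))
    identity = solve-∀

    double : ∀ a d n → 2 * ((a + d) + (n + n)) ≡ 2 * a + (2 * d + 4 * n)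
    double = solve-∀

    double-suc : ∀ e → 2 * (e + 1) ≡ 2 * e + 2
    double-suc = solve-∀

  open ≤-Reasoning

  gap-upper : ∀ {a d e} → 2 * e ≤ 2 * a + n * suc n → (a + d) + (n + n) ≤ e + 1 →
    2 * d ≤ suc (suc k) * suc k
  gap-upper {a} {d} {e} p q = +-cancelʳ-≤ (4 * n) _ _ (+-cancelˡ-≤ (2 * a) _ _ (begin
    2 * a + (2 * d + 4 * n)                     ≡⟨ double a d n ⟨
    2 * ((a + d) + (n + n))                     ≤⟨ *-monoʳ-≤ 2 q ⟩
    2 * (e + 1)                                 ≡⟨ double-suc e ⟩
    2 * e + 2                                   ≤⟨ +-monoˡ-≤ 2 p ⟩
    2 * a + n * suc n + 2                       ≡⟨ identity k (2 * a) ⟩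
    2 * a + (suc (suc k) * suc k + 4 * n)       ∎))

  -- At equality no slack is left between the two estimates, so each of them yields the reverse of
  -- the other.
  gap-total : ∀ {a d} → 2 * d ≡ suc (suc k) * suc k → 2 * ((a + d) + (n + n)) ≡ 2 * a + n * suc n + 2
  gap-total {a} {d} eq = trans (double a d n)
    (trans (cong (λ x → 2 * a + (x + 4 * n)) eq) (sym (identity k (2 * a))))

  gap-tight-af : ∀ {a d e} → 2 * d ≡ suc (suc k) * suc k → (a + d) + (n + n) ≤ e + 1 →
    n * suc n + 2 * a ≤ 2 * e
  gap-tight-af {a} {d} {e} eq q = +-cancelʳ-≤ 2 _ _ (begin
    n * suc n + 2 * a + 2       ≡⟨ cong (_+ 2) (+-comm (n * suc n) (2 * a)) ⟩
    2 * a + n * suc n + 2       ≡⟨ gap-total {a} {d} eq ⟨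
    2 * ((a + d) + (n + n))     ≤⟨ *-monoʳ-≤ 2 q ⟩
    2 * (e + 1)                 ≡⟨ double-suc e ⟩
    2 * e + 2                   ∎)

  gap-tight-gf : ∀ {a d e} → 2 * d ≡ suc (suc k) * suc k → 2 * e ≤ 2 * a + n * suc n →
    e + 1 ≤ (a + d) + (n + n)
  gap-tight-gf {a} {d} {e} eq p = *-cancelˡ-≤ 2 (begin
    2 * (e + 1)                 ≡⟨ double-suc e ⟩
    2 * e + 2                   ≤⟨ +-monoˡ-≤ 2 p ⟩
    2 * a + n * suc n + 2       ≡⟨ gap-total {a} {d} eq ⟨
    2 * ((a + d) + (n + n))     ∎)

  gap-lower : ∀ {a d} → 2 * a + n * suc n ≤ 2 * (n * n) → n * n + 1 ≤ (a + d) + 2 * n →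
    suc (suc k) * suc k ≤ 2 * d
  gap-lower {a} {d} p q = +-cancelʳ-≤ (4 * n) _ _ (+-cancelˡ-≤ (2 * a) _ _ (begin
    2 * a + (suc (suc k) * suc k + 4 * n)       ≡⟨ identity k (2 * a) ⟨
    2 * a + n * suc n + 2                       ≤⟨ +-monoˡ-≤ 2 p ⟩
    2 * (n * n) + 2                             ≡⟨ double-suc (n * n) ⟨
    2 * (n * n + 1)                             ≤⟨ *-monoʳ-≤ 2 q ⟩
    2 * ((a + d) + 2 * n)                       ≡⟨ cong (λ m → 2 * ((a + d) + (n + m))) (+-identityʳ n) ⟩
    2 * ((a + d) + (n + n))                     ≡⟨ double a d n ⟩
    2 * a + (2 * d + 4 * n)                     ∎))

module GapBound (k : ℕ) {c : Fin (suc (suc (suc k)) + suc (suc (suc k))) → Bool}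
  (cl : Classes c (suc (suc (suc k))) (suc (suc (suc k))))
  (G : Graph (suc (suc (suc k)) + suc (suc (suc k)))) (bip : Coloured c (adj G))
  {a g : ℕ} (isAf : IsAf G a) (isGf : IsGf G g) where

  open Comparison cl G bip
  open Matchings cl
  open Arithmetic k

  private
    n : ℕ
    n = suc (suc (suc k))

    d : ℕ
    d = g ∸ a

    -- The truncated subtraction is exact by `af≤gf`.
    g≡a+d : g ≡ a + d
    g≡a+d = sym (m+[n∸m]≡n (af≤gf isAf isGf))

  tree-bound : Connected G → (a + d) + (n + n) ≤ cnt E + 1
  tree-bound conn = subst (λ x → x + (n + n) ≤ cnt E + 1) g≡a+d (gf-upper conn zero isGf)

  gap≤ : Connected G → 2 * d ≤ suc (suc k) * suc k
  gap≤ conn = gap-upper {a} {d} (af-lower isAf) (tree-bound conn)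

  -- Non-adjacent extremal vertices would give a co-forcing set of 2n edges, one more than a
  -- spanning tree has.
  tight⇒closing : 2 * d ≡ suc (suc k) * suc k → Closing E
  tight⇒closing eq π ρ π⊑ half = BP.¬-not λ open-ends → absurd (large-coforcing E π ρ half open-ends)
    where
    absurd : (∃ λ T → T ⊆M E × CoForcing E T × 2 * n ≤ cnt T) → ⊥
    absurd (T , T⊆E , cf , large) = no-large-coforcing isGf
      (subst (λ x → cnt E + 1 ≤ x + (n + n)) (sym g≡a+d) (gap-tight-gf {a} {d} eq (af-lower isAf))) T⊆E cf large

  -- Tightness of the anti-forcing estimate gives `Orderable`, that of the tree bound gives
  -- `Closing`.
  tight⇒K : Connected G → HasPM G → 2 * d ≡ suc (suc k) * suc k → G ≅ K n
  tight⇒K conn (M , pm) eq with π , mat ← matching-perm G bip pm = full⇒≅K cl G bip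
    (orderable-closing⇒complete E π (matching-⊑ G bip {M} {π} pm mat)
      (orderable isAf (gap-tight-af {a} {d} eq (tree-bound conn))) (tight⇒closing eq))

  K⇒tight : Connected G → G ≅ K n → 2 * d ≡ suc (suc k) * suc k
  K⇒tight conn iso = ≤-antisym (gap≤ conn) (gap-lower {a} {d} (af-upper full isAf)
    (subst (λ x → n * n + 1 ≤ x + 2 * n) g≡a+d (complete-gf-lower full isGf complete-coforcing-size)))
    where
    full : ∀ i j → E i j ≡ true
    full = ≅K⇒full cl G bip zero iso

theorem3p5 : (n : ℕ) → 3 ≤ n → (G : Graph (n + n)) →
    Connected G → Bipartite G → HasPM G →
    (a g : ℕ) → IsAf G a → IsGf G g →
    (a ≤ g) × (2 * (g ∸ a) ≤ (n ∸ 1) * (n ∸ 2))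
    × ((2 * (g ∸ a) ≡ (n ∸ 1) * (n ∸ 2)) ⇔ (G ≅ K n))
theorem3p5 (suc (suc (suc k))) (s≤s (s≤s (s≤s z≤n))) G conn (c , bip) hasPM a g isAf isGf =
  from-classes (balanced-classes G bip hasPM)
  where
  n = suc (suc (suc k))
  from-classes : Classes c n n → (a ≤ g) × (2 * (g ∸ a) ≤ (n ∸ 1) * (n ∸ 2))
    × ((2 * (g ∸ a) ≡ (n ∸ 1) * (n ∸ 2)) ⇔ (G ≅ K n))
  from-classes cl = Comparison.af≤gf cl G bip isAf isGf , gap≤ conn , mk⇔ (tight⇒K conn hasPM) (K⇒tight conn)
    where open GapBound k cl G bip isAf isGf
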